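{- Let $\mathcal{P}_3(z)=\sum_{n\ge 0} |\mathcal{S}_n\cap Av(\mathbf{4123},\mathbf{1342})|\, z^n$ be the generating function for the permutation class $Av(\mathbf{4123},\mathbf{1342})$. Then $$\mathcal{P}_3(z) = 1+ \frac{z(1-z)(1-2z)\left(1-7z+17z^2-16z^3+4z^4+(1-3z+3z^2)\sqrt{1-4z}\right)}{2-22z+96z^2-220z^3+282z^4-196z^5+64z^6-8z^7}.$$
   Context: A permutation $\sigma$ contains a pattern $\pi$ if some subsequence of $\sigma$ is order-isomorphic to $\pi$; otherwise $\sigma$ avoids $\pi$. For a set $B$ of patterns, $Av(B)$ is the set of permutations avoiding every element of $B$, and $\mathcal{S}_n$ is the set of permutations of length $n$ (the empty permutation is counted for $n=0$). -}

module Defs where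

open import Data.Nat using (ℕ; zero; suc; _∸_; _<ᵇ_; _≡ᵇ_)
open import Data.Bool using (Bool; true; false; _∧_; not)
open import Data.List using (List; []; _∷_; _++_; map; concatMap; length; upTo; filter; zip; lookup)
open import Data.Product using (_,_; proj₁; proj₂)
open import Data.Bool.ListAction using (all; any)
open import Data.Integer using (ℤ; +_; -[1+_]) renaming (_+_ to _+ℤ_; _*_ to _*ℤ_)
open import Relation.Binary.PropositionalEquality using (_≡_)
open import Data.Product using (_×_)

-- Permutations of length n, as lists (σ(1),…,σ(n)) of values in {0,…,n-1}

words : ℕ → List ℕ → List (List ℕ)
words zero    alph = [] ∷ []
words (suc k) alph = concatMap (λ x → map (x ∷_) (words k alph)) alph

notElem : ℕ → List ℕ → Bool
notElem x []       = true
notElem x (y ∷ ys) = not (x ≡ᵇ y) ∧ notElem x ys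

distinct : List ℕ → Bool
distinct []       = true
distinct (x ∷ xs) = notElem x xs ∧ distinct xs

Sn : ℕ → List (List ℕ)
Sn n = filter (λ w → distinct w Data.Bool.≟ true) (words n (upTo n))
  where import Data.Bool

subseqs : List ℕ → List (List ℕ)
subseqs []       = [] ∷ []
subseqs (x ∷ xs) = subseqs xs ++ map (x ∷_) (subseqs xs)

_⇔ᵇ_ : Bool → Bool → Bool
true  ⇔ᵇ b = b
false ⇔ᵇ b = not b

orderIso : List ℕ → List ℕ → Bool
orderIso p s = (length p ≡ᵇ length s) ∧
  all (λ u → all (λ v → (proj₁ u <ᵇ proj₁ v) ⇔ᵇ (proj₂ u <ᵇ proj₂ v)) (zip p s)) (zip p s)

contains : List ℕ → List ℕ → Bool
contains σ π = any (orderIso π) (subseqs σ)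

avoidsAll : List (List ℕ) → List ℕ → Bool
avoidsAll B σ = all (λ π → not (contains σ π)) B

-- the patterns 4123 and 1342 (0-based values)
p4123 : List ℕ
p4123 = 3 ∷ 0 ∷ 1 ∷ 2 ∷ []

p1342 : List ℕ
p1342 = 0 ∷ 2 ∷ 3 ∷ 1 ∷ []

countAv : ℕ → ℕ
countAv n = length (filter (λ σ → avoidsAll (p4123 ∷ p1342 ∷ []) σ Data.Bool.≟ true) (Sn n))
  where import Data.Bool

Series : Set
Series = ℕ → ℤ

sumℤ : List ℤ → ℤ
sumℤ []       = + 0
sumℤ (x ∷ xs) = x +ℤ sumℤ xs

_⊕_ : Series → Series → Series
(f ⊕ g) n = f n +ℤ g n

_⊛_ : Series → Series → Series
(f ⊛ g) n = sumℤ (map (λ i → f i *ℤ g (n ∸ i)) (upTo (suc n)))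

poly : List ℤ → Series
poly []       n       = + 0
poly (c ∷ cs) zero    = c
poly (c ∷ cs) (suc n) = poly cs n

P3 : Series
P3 n = + countAv n

neg : ℕ → ℤ
neg zero    = + 0
neg (suc k) = -[1+ k ]

Den : Series
Den = poly (+ 2 ∷ neg 22 ∷ + 96 ∷ neg 220 ∷ + 282 ∷ neg 196 ∷ + 64 ∷ neg 8 ∷ [])

-- z(1-z)(1-2z) = z - 3z² + 2z³
Fac : Series
Fac = poly (+ 0 ∷ + 1 ∷ neg 3 ∷ + 2 ∷ [])

PolA : Series
PolA = poly (+ 1 ∷ neg 7 ∷ + 17 ∷ neg 16 ∷ + 4 ∷ [])

PolB : Series
PolB = poly (+ 1 ∷ neg 3 ∷ + 3 ∷ [])

OneMinus4z : Series
OneMinus4z = poly (+ 1 ∷ neg 4 ∷ [])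

IsSqrt1m4z : Series → Set
IsSqrt1m4z s = (s 0 ≡ + 1) × (∀ n → (s ⊛ s) n ≡ OneMinus4z n)

-- Permutations are grown by inserting a new first entry.  A new first entry v creates 4123 iff
-- some 123 lies entirely below v, and 1342 iff some 231 lies entirely above it, so the admissible
-- v form an interval (window) of sites.  Inside the window only two things matter: which
-- ascents and which inversions exist between given heights.  They fall into three shapes G, H, K
-- with two integer parameters each, which yields a generating tree with finitely many rules.
-- In the resulting system of power series all differences in one parameter are independent of
-- the other one, because a sequence of series each of which is X times the next vanishes.  This
-- reduces the system to a_{n+1} = a_n + X a_{n+2} for the series a_n of H 1 n, that is, to
-- 2X a_{n+1} = (1 − s) a_n, and to linear equations that determine a_0 and the series of G 0 0.
module Submission where

open import Defs renaming (_⊕_ to infixl 6 _⊕_; _⊛_ to infixl 7 _⊛_)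
open import Algebra using (CommutativeRing; RawRing)
open import Algebra.Solver.Ring.AlmostCommutativeRing using (fromCommutativeRing; _-Raw-AlmostCommutative⟶_)
import Algebra.Solver.Ring
open import Data.Bool using (Bool; true; false; _∧_; _∨_; not)
import Data.Bool as Bool
open import Data.Bool.ListAction using (any; all)
open import Data.Bool.Properties using (T-≡; ∨-zeroʳ)
open import Data.Empty using (⊥-elim)
open import Data.Integer using (ℤ; -1ℤ; +_; -_) renaming (_+_ to infixl 6 _+ℤ_; _*_ to infixl 7 _*ℤ_)
import Data.Integer as ℤ
import Data.Integer.Properties as ℤ
open import Data.Integer.Tactic.RingSolver using (solve-∀)
open import Data.List using (List; []; _∷_; map; length; _++_; concatMap; filter; zip; upTo; applyDownFrom)
open import Data.List.Membership.Propositional using (_∈_)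
open import Data.List.Membership.Propositional.Properties using
  (∈-map⁺; ∈-map⁻; ∈-++⁻; ∈-++⁺ˡ; ∈-++⁺ʳ; ∈-filter⁺; ∈-filter⁻; ∈-upTo⁺; ∈-upTo⁻)
open import Data.List.Membership.Propositional.Properties.WithK using (unique∧set⇒bag)
open import Data.List.Properties using
  (length-map; map-++; map-∘; map-id; map-cong; map-applyUpTo; ∷-injectiveˡ; ∷-injectiveʳ)
open import Data.List.Relation.Binary.BagAndSetEquality using (∼bag⇒↭)
open import Data.List.Relation.Binary.Disjoint.Propositional using (Disjoint)
open import Data.List.Relation.Binary.Permutation.Propositional.Properties using (↭-length)
open import Data.List.Relation.Binary.Sublist.Propositional using (_⊆_; []; _∷_; _∷ʳ_; from∈)
open import Data.List.Relation.Binary.Sublist.Propositional.Properties using (map⁺)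
open import Data.List.Relation.Unary.All using (All; []; _∷_)
import Data.List.Relation.Unary.All as All
import Data.List.Relation.Unary.All.Properties as All
open import Data.List.Relation.Unary.AllPairs using ([]; _∷_)
open import Data.List.Relation.Unary.Any using (here; there)
open import Data.List.Relation.Unary.Unique.Propositional using (Unique)
import Data.List.Relation.Unary.Unique.Propositional.Properties as Unique
open import Data.Maybe using (Maybe; just; nothing)
open import Data.Nat using
  (ℕ; zero; suc; _+_; _∸_; _≤_; _<_; z≤n; s≤s; z<s; s<s; s≤s⁻¹; _≟_; _<ᵇ_)
open import Data.Nat.Induction using (<-rec)
open import Data.Nat.ListAction using (sum)
open import Data.Nat.ListAction.Properties using (sum-++)
open import Data.Nat.Properties
open import Data.Product using (_×_; _,_; proj₁; proj₂; ∃-syntax)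
open import Data.Sum using (_⊎_; inj₁; inj₂)
open import Function using (_∘_; mk⇔; Equivalence)
open import Level using (0ℓ)
open import Relation.Binary.PropositionalEquality using
  (_≡_; _≢_; refl; sym; trans; cong; cong₂; subst; module ≡-Reasoning)
open import Relation.Nullary using (¬_; yes; no)


-- Inserting a first entry

-- The obstacle is an infinite system in two parameters, for which the usual kernel method would
-- substitute algebraic series. Uniqueness takes its place: once the inhomogeneous term of a
-- recursion along one parameter is free of that parameter, a constant solution can be written down,
-- and it is the only one. The recurrence for the series of `H 1 n` has characteristic equation X r²
-- - r + 1 = 0. Of its roots (1 ± s)/(2X) only the Catalan series (1 - s)/(2X) is a power series,
-- and the same uniqueness argument rules out the other one. Since coefficients are integers,
-- denominators such as 1 - X are cleared and stay as factors until a final cancellation. Each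
-- algebraic step is a certificate: explicit multiples of known equations, whose sum the ring solver
-- compares with the goal.

-- bump v makes room for a new value v; unbump v is its left inverse and its lower adjoint.
bump unbump : ℕ → ℕ → ℕ
bump zero    w       = suc w
bump (suc v) zero    = zero
bump (suc v) (suc w) = suc (bump v w)

unbump zero    zero    = zero
unbump zero    (suc x) = x
unbump (suc v) zero    = zero
unbump (suc v) (suc x) = suc (unbump v x)

unbump-bump : ∀ v w → unbump v (bump v w) ≡ w
unbump-bump zero    w       = refl
unbump-bump (suc v) zero    = refl
unbump-bump (suc v) (suc w) = cong suc (unbump-bump v w)

bump-unbump : ∀ v x → x ≢ v → bump v (unbump v x) ≡ x
bump-unbump zero    zero    x≢v = ⊥-elim (x≢v refl)
bump-unbump zero    (suc x) x≢v = refl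
bump-unbump (suc v) zero    x≢v = refl
bump-unbump (suc v) (suc x) x≢v = cong suc (bump-unbump v x (λ e → x≢v (cong suc e)))

bump-≢ : ∀ v w → bump v w ≢ v
bump-≢ (suc v) (suc w) e = bump-≢ v w (suc-injective e)

bump-mono-< : ∀ v {a b} → a < b → bump v a < bump v b
bump-mono-< zero    a<b = s<s a<b
bump-mono-< (suc v) {zero}  {suc b} a<b = z<s
bump-mono-< (suc v) {suc a} {suc b} a<b = s<s (bump-mono-< v (s≤s⁻¹ a<b))

bump-cancel-< : ∀ v {a b} → bump v a < bump v b → a < b
bump-cancel-< zero    p = s≤s⁻¹ p
bump-cancel-< (suc v) {zero}  {suc b} p = z<s
bump-cancel-< (suc v) {suc a} {suc b} p = s<s (bump-cancel-< v (s≤s⁻¹ p))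

≤-bump : ∀ v {x w} → unbump v x ≤ w → x ≤ bump v w
≤-bump zero    {zero}           p = z≤n
≤-bump zero    {suc x}          p = s≤s p
≤-bump (suc v) {zero}           p = z≤n
≤-bump (suc v) {suc x} {suc w}  p = s≤s (≤-bump v (s≤s⁻¹ p))

unbump-≤ : ∀ v {x w} → x ≤ bump v w → unbump v x ≤ w
unbump-≤ zero    {zero}          p = z≤n
unbump-≤ zero    {suc x}         p = s≤s⁻¹ p
unbump-≤ (suc v) {zero}          p = z≤n
unbump-≤ (suc v) {suc x} {suc w} p = s≤s (unbump-≤ v (s≤s⁻¹ p))

bump-< : ∀ v {w y} → w < unbump v y → bump v w < y
bump-< v {w} {y} p = ≰⇒> λ y≤ → <⇒≱ p (unbump-≤ v y≤)

<-unbump : ∀ v {w y} → bump v w < y → w < unbump v y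
<-unbump v p = ≰⇒> λ u≤ → <⇒≱ p (≤-bump v u≤)

unbump-low : ∀ {v x} → x ≤ v → unbump v x ≡ x
unbump-low {zero}  {zero}  p = refl
unbump-low {suc v} {zero}  p = refl
unbump-low {suc v} {suc x} p = cong suc (unbump-low (s≤s⁻¹ p))

unbump-high : ∀ {v x} → v ≤ x → unbump v (suc x) ≡ x
unbump-high {zero}          p = refl
unbump-high {suc v} {suc x} p = cong suc (unbump-high (s≤s⁻¹ p))

data Split (v : ℕ) : ℕ → Set where
  low  : ∀ {x} → x ≤ v → unbump v x ≡ x → Split v x
  high : ∀ {x} → v ≤ x → unbump v (suc x) ≡ x → Split v (suc x)

split : ∀ v x → Split v x
split v x with ≤-<-connex x v
split v x       | inj₁ x≤v = low x≤v (unbump-low x≤v)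
split v (suc x) | inj₂ v<x = high (s≤s⁻¹ v<x) (unbump-high (s≤s⁻¹ v<x))

insert : ℕ → List ℕ → List ℕ
insert v τ = v ∷ map (bump v) τ

⊆-map⁻ : ∀ (f : ℕ → ℕ) τ {s} → s ⊆ map f τ → ∃[ t ] t ⊆ τ × s ≡ map f t
⊆-map⁻ f []      []        = [] , [] , refl
⊆-map⁻ f (x ∷ τ) (.(f x) ∷ʳ p) with ⊆-map⁻ f τ p
... | t , q , e = t , x ∷ʳ q , e
⊆-map⁻ f (x ∷ τ) (refl ∷ p) with ⊆-map⁻ f τ p
... | t , q , e = x ∷ t , refl ∷ q , cong (f x ∷_) e

-- The thresholds x and y restrict the values that may take part.
Asc Inv : ℕ → ℕ → List ℕ → Set
Asc x y τ = ∃[ a ] ∃[ b ] (a ∷ b ∷ []) ⊆ τ × x ≤ a × a < b × b < y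
Inv x y τ = ∃[ u ] ∃[ w ] (u ∷ w ∷ []) ⊆ τ × x ≤ u × y ≤ w × w < x

123Below 231Above : ℕ → List ℕ → Set
123Below y τ = ∃[ a ] ∃[ b ] ∃[ c ] (a ∷ b ∷ c ∷ []) ⊆ τ × a < b × b < c × c < y
231Above x τ = ∃[ a ] ∃[ b ] ∃[ c ] (b ∷ c ∷ a ∷ []) ⊆ τ × x ≤ a × a < b × b < c

Has4123 Has1342 : List ℕ → Set
Has4123 τ = ∃[ a ] ∃[ b ] ∃[ c ] ∃[ d ] (d ∷ a ∷ b ∷ c ∷ []) ⊆ τ × a < b × b < c × c < d
Has1342 τ = ∃[ a ] ∃[ b ] ∃[ c ] ∃[ d ] (a ∷ c ∷ d ∷ b ∷ []) ⊆ τ × a < b × b < c × c < d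

module _ (v : ℕ) (τ : List ℕ) where

  private ρ = map (bump v) τ

  -- `unbump v` is adjoint to `bump v`, so both kinds of bounds on bumped values, x ≤ `bump v w` and
  -- `bump v w` < y, pull back to bounds on w by applying `unbump v` to the threshold. The lemmas
  -- for the other restricted patterns rest on the same fact.
  Asc-map⁺ : ∀ {x y} → Asc (unbump v x) (unbump v y) τ → Asc x y ρ
  Asc-map⁺ (_ , _ , s , p , q , r) =
    _ , _ , map⁺ (bump v) s , ≤-bump v p , bump-mono-< v q , bump-< v r

  Asc-map⁻ : ∀ {x y} → Asc x y ρ → Asc (unbump v x) (unbump v y) τ
  Asc-map⁻ (_ , _ , s , p , q , r) with ⊆-map⁻ (bump v) τ s
  ... | a ∷ b ∷ [] , t , refl = a , b , t , unbump-≤ v p , bump-cancel-< v q , <-unbump v r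

  Inv-map⁺ : ∀ {x y} → Inv (unbump v x) (unbump v y) τ → Inv x y ρ
  Inv-map⁺ (_ , _ , s , p , q , r) =
    _ , _ , map⁺ (bump v) s , ≤-bump v p , ≤-bump v q , bump-< v r

  Inv-map⁻ : ∀ {x y} → Inv x y ρ → Inv (unbump v x) (unbump v y) τ
  Inv-map⁻ (_ , _ , s , p , q , r) with ⊆-map⁻ (bump v) τ s
  ... | a ∷ b ∷ [] , t , refl = a , b , t , unbump-≤ v p , unbump-≤ v q , <-unbump v r

  123Below-map⁺ : ∀ {y} → 123Below (unbump v y) τ → 123Below y ρ
  123Below-map⁺ (_ , _ , _ , s , p , q , r) =
    _ , _ , _ , map⁺ (bump v) s , bump-mono-< v p , bump-mono-< v q , bump-< v r

  123Below-map⁻ : ∀ {y} → 123Below y ρ → 123Below (unbump v y) τ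
  123Below-map⁻ (_ , _ , _ , s , p , q , r) with ⊆-map⁻ (bump v) τ s
  ... | a ∷ b ∷ c ∷ [] , t , refl = a , b , c , t , bump-cancel-< v p , bump-cancel-< v q , <-unbump v r

  231Above-map⁺ : ∀ {x} → 231Above (unbump v x) τ → 231Above x ρ
  231Above-map⁺ (_ , _ , _ , s , p , q , r) =
    _ , _ , _ , map⁺ (bump v) s , ≤-bump v p , bump-mono-< v q , bump-mono-< v r

  231Above-map⁻ : ∀ {x} → 231Above x ρ → 231Above (unbump v x) τ
  231Above-map⁻ (_ , _ , _ , s , p , q , r) with ⊆-map⁻ (bump v) τ s
  ... | b ∷ c ∷ a ∷ [] , t , refl = a , b , c , t , unbump-≤ v p , bump-cancel-< v q , bump-cancel-< v r

  Has4123-map⁺ : Has4123 τ → Has4123 ρ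
  Has4123-map⁺ (_ , _ , _ , _ , s , p , q , r) =
    _ , _ , _ , _ , map⁺ (bump v) s , bump-mono-< v p , bump-mono-< v q , bump-mono-< v r

  Has4123-map⁻ : Has4123 ρ → Has4123 τ
  Has4123-map⁻ (_ , _ , _ , _ , s , p , q , r) with ⊆-map⁻ (bump v) τ s
  ... | d ∷ a ∷ b ∷ c ∷ [] , t , refl =
    a , b , c , d , t , bump-cancel-< v p , bump-cancel-< v q , bump-cancel-< v r

  Has1342-map⁺ : Has1342 τ → Has1342 ρ
  Has1342-map⁺ (_ , _ , _ , _ , s , p , q , r) =
    _ , _ , _ , _ , map⁺ (bump v) s , bump-mono-< v p , bump-mono-< v q , bump-mono-< v r

  Has1342-map⁻ : Has1342 ρ → Has1342 τ
  Has1342-map⁻ (_ , _ , _ , _ , s , p , q , r) with ⊆-map⁻ (bump v) τ s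
  ... | a ∷ c ∷ d ∷ b ∷ [] , t , refl =
    a , b , c , d , t , bump-cancel-< v p , bump-cancel-< v q , bump-cancel-< v r

  Asc-insert⁻ : ∀ {x y} → Asc x y (insert v τ) → (x ≤ v × suc v < y) ⊎ Asc (unbump v x) (unbump v y) τ
  Asc-insert⁻ (a , b , _ ∷ʳ s , r)       = inj₂ (Asc-map⁻ (a , b , s , r))
  Asc-insert⁻ (_ , b , refl ∷ s , p , q , r) = inj₁ (p , ≤-<-trans q r)

  Asc-insert⁺ : ∀ {x y} → Asc (unbump v x) (unbump v y) τ → Asc x y (insert v τ)
  Asc-insert⁺ h with Asc-map⁺ h
  ... | a , b , s , r = a , b , v ∷ʳ s , r

  -- The old value v is bumped to `suc v`, which makes the tightest ascent that starts with the new
  -- entry.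
  Asc-insert-new : ∀ {x y} → x ≤ v → suc v < y → v ∈ τ → Asc x y (insert v τ)
  Asc-insert-new x≤v v<y v∈τ =
    v , suc v , refl ∷ from∈ (subst (_∈ ρ) bump-self (∈-map⁺ (bump v) v∈τ)) , x≤v , ≤-refl , v<y
    where
    bump-self : bump v v ≡ suc v
    bump-self = trans (cong (bump v) (sym (unbump-high ≤-refl))) (bump-unbump v (suc v) 1+n≢n)

  Inv-insert⁻ : ∀ {x y} → Inv x y (insert v τ) → (x ≤ v × y < x) ⊎ Inv (unbump v x) (unbump v y) τ
  Inv-insert⁻ (a , b , _ ∷ʳ s , r)       = inj₂ (Inv-map⁻ (a , b , s , r))
  Inv-insert⁻ (_ , b , refl ∷ s , p , q , r) = inj₁ (p , ≤-<-trans q r)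

  Inv-insert⁺ : ∀ {x y} → Inv (unbump v x) (unbump v y) τ → Inv x y (insert v τ)
  Inv-insert⁺ h with Inv-map⁺ h
  ... | a , b , s , r = a , b , v ∷ʳ s , r

  Inv-insert-new : ∀ {x y} → x ≤ v → y < x → y ∈ τ → Inv x y (insert v τ)
  Inv-insert-new {x} {y} x≤v y<x y∈τ =
    v , y , refl ∷ from∈ (subst (_∈ ρ) bump-y (∈-map⁺ (bump v) y∈τ)) , x≤v , ≤-refl , y<x
    where
    y<v = <-≤-trans y<x x≤v
    bump-y : bump v y ≡ y
    bump-y = trans (cong (bump v) (sym (unbump-low (<⇒≤ y<v)))) (bump-unbump v y (<⇒≢ y<v))

  -- Either v plays the 1 or it takes no part. In the first case the other two entries are at least
  -- `suc v`, and `unbump v (suc v)` is v.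
  123Below-insert⁻ : ∀ {y} → 123Below y (insert v τ) → Asc v (unbump v y) τ ⊎ 123Below (unbump v y) τ
  123Below-insert⁻ (a , b , c , _ ∷ʳ s , r) = inj₂ (123Below-map⁻ (a , b , c , s , r))
  123Below-insert⁻ {y} (_ , b , c , refl ∷ s , r) =
    inj₁ (subst (λ x → Asc x (unbump v y) τ) (unbump-high ≤-refl) (Asc-map⁻ (b , c , s , r)))

  123Below-insert⁺ : ∀ {y} → Asc v (unbump v y) τ ⊎ 123Below (unbump v y) τ → 123Below y (insert v τ)
  123Below-insert⁺ {y} (inj₁ h)
    with Asc-map⁺ (subst (λ x → Asc x (unbump v y) τ) (sym (unbump-high ≤-refl)) h)
  ... | b , c , s , r = v , b , c , refl ∷ s , r
  123Below-insert⁺ (inj₂ h) with 123Below-map⁺ h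
  ... | a , b , c , s , r = a , b , c , v ∷ʳ s , r

  -- If v plays the 2, the entries for 3 and 1 lie on either side of it, in this order: an inversion
  -- across v. It is read off at the threshold `suc v`, which pulls back to v.
  231Above-insert⁻ : ∀ {x} → 231Above x (insert v τ) → Inv v (unbump v x) τ ⊎ 231Above (unbump v x) τ
  231Above-insert⁻ (a , b , c , _ ∷ʳ s , r) = inj₂ (231Above-map⁻ (a , b , c , s , r))
  231Above-insert⁻ {x} (a , _ , c , refl ∷ s , p , q , r) =
    inj₁ (subst (λ u → Inv u (unbump v x) τ) (unbump-high ≤-refl)
      (Inv-map⁻ (c , a , s , r , p , m<n⇒m<1+n q)))

  231Above-insert⁺ : ∀ {x} → Inv v (unbump v x) τ ⊎ 231Above (unbump v x) τ → 231Above x (insert v τ)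
  231Above-insert⁺ {x} (inj₁ (u , w , s , p , q , r)) =
    bump v w , v , bump v u , refl ∷ map⁺ (bump v) s , ≤-bump v q ,
    bump-< v (subst (w <_) (sym (unbump-low ≤-refl)) r) ,
    ≤-bump v (subst (_≤ u) (sym (unbump-high ≤-refl)) p)
  231Above-insert⁺ (inj₂ h) with 231Above-map⁺ h
  ... | a , b , c , s , r = a , b , c , v ∷ʳ s , r

  Has4123-insert⁻ : Has4123 (insert v τ) → 123Below v τ ⊎ Has4123 τ
  Has4123-insert⁻ (a , b , c , d , _ ∷ʳ s , r) = inj₂ (Has4123-map⁻ (a , b , c , d , s , r))
  Has4123-insert⁻ (a , b , c , _ , refl ∷ s , r) =
    inj₁ (subst (λ y → 123Below y τ) (unbump-low ≤-refl) (123Below-map⁻ (a , b , c , s , r)))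

  Has4123-insert⁺ : 123Below v τ ⊎ Has4123 τ → Has4123 (insert v τ)
  Has4123-insert⁺ (inj₁ h) with 123Below-map⁺ (subst (λ y → 123Below y τ) (sym (unbump-low ≤-refl)) h)
  ... | a , b , c , s , r = a , b , c , v , refl ∷ s , r
  Has4123-insert⁺ (inj₂ h) with Has4123-map⁺ h
  ... | a , b , c , d , s , r = a , b , c , d , v ∷ʳ s , r

  Has1342-insert⁻ : Has1342 (insert v τ) → 231Above v τ ⊎ Has1342 τ
  Has1342-insert⁻ (a , b , c , d , _ ∷ʳ s , r) = inj₂ (Has1342-map⁻ (a , b , c , d , s , r))
  Has1342-insert⁻ (_ , b , c , d , refl ∷ s , r) =
    inj₁ (subst (λ x → 231Above x τ) (unbump-high ≤-refl) (231Above-map⁻ (b , c , d , s , r)))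

  Has1342-insert⁺ : 231Above v τ ⊎ Has1342 τ → Has1342 (insert v τ)
  Has1342-insert⁺ (inj₁ h) with 231Above-map⁺ (subst (λ x → 231Above x τ) (sym (unbump-high ≤-refl)) h)
  ... | b , c , d , s , r = v , b , c , d , refl ∷ s , r
  Has1342-insert⁺ (inj₂ h) with Has1342-map⁺ h
  ... | a , b , c , d , s , r = a , b , c , d , v ∷ʳ s , r

record Perm (n : ℕ) (τ : List ℕ) : Set where
  field
    len     : length τ ≡ n
    bounded : All (_< n) τ
    unique  : Unique τ
    full    : ∀ {w} → w < n → w ∈ τ

bump-injective : ∀ v {a b} → bump v a ≡ bump v b → a ≡ b
bump-injective v {a} {b} e = trans (sym (unbump-bump v a)) (trans (cong (unbump v) e) (unbump-bump v b))

Perm-insert : ∀ {n v τ} → v ≤ n → Perm n τ → Perm (suc n) (insert v τ)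
Perm-insert {n} {v} {τ} v≤n P = record
  { len     = cong suc (trans (length-map (bump v) τ) len)
  ; bounded = s≤s v≤n ∷ All.map⁺ (All.map (λ {w} w<n → bump-< v (subst (w <_) (sym (unbump-high v≤n)) w<n)) bounded)
  ; unique  = All.map⁺ (All.universal (λ w e → bump-≢ v w (sym e)) τ) ∷ Unique.map⁺ (bump-injective v) unique
  ; full    = present
  }
  where
  open Perm P
  present : ∀ {w} → w < suc n → w ∈ insert v τ
  present {w} w<1+n with w ≟ v
  ... | yes refl = here refl
  ... | no w≢v   = there (subst (_∈ map (bump v) τ) (bump-unbump v w w≢v)
    (∈-map⁺ (bump v) (full (subst (unbump v w <_) (unbump-high v≤n)
      (<-unbump v (subst (_< suc n) (sym (bump-unbump v w w≢v)) w<1+n))))))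

-- The window of admissible sites

-- A new first entry v creates neither pattern exactly when b ≤ v ≤ e.  Within this window of
-- sites, ascents are governed by c (the lowest top of an ascent, all bottoms being below c), and inversions by Z, the
-- sites x such that no value ≥ x precedes a value of the window below x.
record Window (n b c e : ℕ) (Z : ℕ → Set) (τ : List ℕ) : Set where
  field
    perm     : Perm n τ
    b≤c      : b ≤ c
    c≤e      : c ≤ e
    e≤n      : e ≤ n
    asc⁺     : ∀ {x y} → b ≤ x → x < c → c < y → y ≤ e → Asc x y τ
    asc⁻     : ∀ {x y} → b ≤ x → y ≤ e → Asc x y τ → x < c × c < y
    inv⁺     : ∀ {x y} → b ≤ y → y < x → x ≤ e → ¬ Z x → Inv x y τ
    inv⁻     : ∀ {x y} → b ≤ y → x ≤ e → Inv x y τ → ¬ Z x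
    below⁺   : ∀ {y} → e < y → y ≤ n → 123Below y τ
    below⁻   : ∀ {y} → 123Below y τ → e < y
    above⁺   : ∀ {x} → x < b → 231Above x τ
    above⁻   : ∀ {x} → 231Above x τ → x < b
    no4123   : ¬ Has4123 τ
    no1342   : ¬ Has1342 τ

Inv-< : ∀ {x y τ} → Inv x y τ → y < x
Inv-< (_ , _ , _ , _ , q , r) = ≤-<-trans q r

≤-unbump : ∀ {v b} x → b ≤ v → b ≤ x → b ≤ unbump v x
≤-unbump {v} {b} x b≤v b≤x with split v x
... | low _ eq      = subst (b ≤_) (sym eq) b≤x
... | high v≤x eq   = subst (b ≤_) (sym eq) (≤-trans b≤v v≤x)

unbump-≤-suc : ∀ {v e} y → v ≤ e → y ≤ suc e → unbump v y ≤ e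
unbump-≤-suc {v} {e} y v≤e y≤ with split v y
... | low y≤v eq = subst (_≤ e) (sym eq) (≤-trans y≤v v≤e)
... | high _ eq  = subst (_≤ e) (sym eq) (s≤s⁻¹ y≤)

suc-<-unbump : ∀ {v e} y → v ≤ e → e < unbump v y → suc e < y
suc-<-unbump {v} {e} y v≤e p = ≰⇒> λ y≤ → <⇒≱ p (unbump-≤-suc y v≤e y≤)

unbump-<-cancel : ∀ {v b} x → b ≤ v → unbump v x < b → x < b
unbump-<-cancel {v} {b} x b≤v p = ≰⇒> λ b≤x → <⇒≱ p (≤-unbump x b≤v b≤x)

module _ {n b c e Z τ} (W : Window n b c e Z τ) {v} (b≤v : b ≤ v) (v≤e : v ≤ e) where
  open Window W

  private
    v≤n : v ≤ n
    v≤n = ≤-trans v≤e e≤n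

    no4123′ : ¬ Has4123 (insert v τ)
    no4123′ h with Has4123-insert⁻ v τ h
    ... | inj₁ p = <⇒≱ (below⁻ p) v≤e
    ... | inj₂ p = no4123 p

    no1342′ : ¬ Has1342 (insert v τ)
    no1342′ h with Has1342-insert⁻ v τ h
    ... | inj₁ p = <⇒≱ (above⁻ p) b≤v
    ... | inj₂ p = no1342 p

    -- The new upper end of the window is suc e₀, where e₀ is the lowest top of an ascent above v.
    module Below {e₀} (v≤e₀ : v ≤ e₀) (e₀≤e : e₀ ≤ e)
      (none : ∀ {y} → y ≤ e₀ → ¬ Asc v y τ)
      (some : ∀ {y} → e₀ < y → y ≤ n → Asc v y τ ⊎ 123Below y τ) where

      below⁺′ : ∀ {y} → suc e₀ < y → y ≤ suc n → 123Below y (insert v τ)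
      below⁺′ {suc y} (s≤s e₀<y) (s≤s y≤n) = 123Below-insert⁺ v τ
        (subst (λ u → Asc v u τ ⊎ 123Below u τ) (sym (unbump-high (≤-trans v≤e₀ (<⇒≤ e₀<y)))) (some e₀<y y≤n))

      below⁻′ : ∀ {y} → 123Below y (insert v τ) → suc e₀ < y
      below⁻′ {y} h with 123Below-insert⁻ v τ h
      ... | inj₁ p = suc-<-unbump y v≤e₀ (≰⇒> λ y≤ → none y≤ p)
      ... | inj₂ p = suc-<-unbump y v≤e₀ (≤-<-trans e₀≤e (below⁻ p))

  -- Every window value below v now ends an occurrence of 231, so the window starts at v.
  insert-cutting : ∀ {Z′ e₀} → ¬ Z v → v ≤ e₀ → e₀ ≤ e →
    (∀ {y} → y ≤ e₀ → ¬ Asc v y τ) → (∀ {y} → e₀ < y → y ≤ e → Asc v y τ) →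
    (∀ {x} → v < x → Z′ (suc x) → Z x) → (∀ {x} → v < x → x ≤ e₀ → Z x → Z′ (suc x)) →
    Z′ (suc v) → Window (suc n) v (suc v) (suc e₀) Z′ (insert v τ)
  insert-cutting {Z′} {e₀} ¬Zv v≤e₀ e₀≤e none some Z′⇒Z Z⇒Z′ Z′v = record
    { perm   = Perm-insert v≤n perm
    ; b≤c    = n≤1+n v
    ; c≤e    = s≤s v≤e₀
    ; e≤n    = s≤s (≤-trans e₀≤e e≤n)
    ; asc⁺   = λ v≤x x<1+v v<y y≤e → Asc-insert-new v τ (s≤s⁻¹ x<1+v) v<y (Perm.full perm (v<n v<y y≤e))
    ; asc⁻   = asc⁻′
    ; inv⁺   = inv⁺′
    ; inv⁻   = inv⁻′
    ; below⁺ = Below.below⁺′ v≤e₀ e₀≤e none some′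
    ; below⁻ = Below.below⁻′ v≤e₀ e₀≤e none some′
    ; above⁺ = above⁺′
    ; above⁻ = above⁻′
    ; no4123 = no4123′
    ; no1342 = no1342′
    }
    where
    some′ : ∀ {y} → e₀ < y → y ≤ n → Asc v y τ ⊎ 123Below y τ
    some′ {y} e₀<y y≤n with ≤-<-connex y e
    ... | inj₁ y≤e = inj₁ (some e₀<y y≤e)
    ... | inj₂ e<y = inj₂ (below⁺ e<y y≤n)

    v<n : ∀ {y} → suc v < y → y ≤ suc e₀ → v < n
    v<n v<y y≤e = ≤-trans (s≤s⁻¹ (≤-trans v<y y≤e)) (≤-trans e₀≤e e≤n)

    asc⁻′ : ∀ {x y} → v ≤ x → y ≤ suc e₀ → Asc x y (insert v τ) → x < suc v × suc v < y
    asc⁻′ {x} {y} v≤x y≤ h with Asc-insert⁻ v τ h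
    ... | inj₁ (x≤v , v<y) = s≤s x≤v , v<y
    ... | inj₂ (p , q , s , x≤p , r) =
      ⊥-elim (none (unbump-≤-suc y v≤e₀ y≤) (p , q , s , ≤-trans (≤-unbump x ≤-refl v≤x) x≤p , r))

    inv⁺′ : ∀ {x y} → v ≤ y → y < x → x ≤ suc e₀ → ¬ Z′ x → Inv x y (insert v τ)
    inv⁺′ {suc x} {y} v≤y (s≤s y≤x) (s≤s x≤e₀) ¬Z′x with m≤n⇒m<n∨m≡n (≤-trans v≤y y≤x)
    -- The only window value below `suc v` is the new first entry v. Nothing precedes it, so `suc v`
    -- is exceptional.
    ... | inj₂ refl = ⊥-elim (¬Z′x Z′v)
    ... | inj₁ v<x  = Inv-insert⁺ v τ (subst (λ u → Inv u (unbump v y) τ) (sym (unbump-high (<⇒≤ v<x)))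
      (inv⁺ (≤-trans b≤v (≤-unbump y ≤-refl v≤y)) below-x (≤-trans x≤e₀ e₀≤e) (λ Zx → ¬Z′x (Z⇒Z′ v<x x≤e₀ Zx))))
      where
      below-x : unbump v y < x
      below-x with split v y
      ... | low y≤v eq = subst (_< x) (sym eq) (≤-<-trans y≤v v<x)
      ... | high _ eq  = subst (_< x) (sym eq) y≤x

    inv⁻′ : ∀ {x y} → v ≤ y → x ≤ suc e₀ → Inv x y (insert v τ) → ¬ Z′ x
    inv⁻′ {x} {y} v≤y x≤ h with Inv-insert⁻ v τ h
    ... | inj₁ (x≤v , y<x) = ⊥-elim (<⇒≱ y<x (≤-trans x≤v v≤y))
    ... | inj₂ p with split v x
    ...   | low x≤v eq = ⊥-elim (<⇒≱ (Inv-< (subst (λ u → Inv u (unbump v y) τ) eq p))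
                           (≤-trans x≤v (≤-unbump y ≤-refl v≤y)))
    ...   | high {x′} v≤x eq = λ Z′x → inv⁻ (≤-trans b≤v (≤-unbump y ≤-refl v≤y)) (≤-trans (s≤s⁻¹ x≤) e₀≤e) p′
                           (Z′⇒Z (≤-<-trans (≤-unbump y ≤-refl v≤y) (Inv-< p′)) Z′x)
      where p′ = subst (λ u → Inv u (unbump v y) τ) eq p

    above⁺′ : ∀ {x} → x < v → 231Above x (insert v τ)
    above⁺′ {x} x<v = 231Above-insert⁺ v τ
      (subst (λ u → Inv v u τ ⊎ 231Above u τ) (sym (unbump-low (<⇒≤ x<v))) old)
      where
      old : Inv v x τ ⊎ 231Above x τ
      old with ≤-<-connex b x
      ... | inj₁ b≤x = inj₁ (inv⁺ b≤x x<v v≤e ¬Zv)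
      ... | inj₂ x<b = inj₂ (above⁺ x<b)

    above⁻′ : ∀ {x} → 231Above x (insert v τ) → x < v
    above⁻′ {x} h with 231Above-insert⁻ v τ h
    ... | inj₁ p = unbump-<-cancel x ≤-refl (Inv-< p)
    ... | inj₂ p = unbump-<-cancel x ≤-refl (<-≤-trans (above⁻ p) b≤v)

  -- No window value is lost.
  insert-keeping : ∀ {Z′ c′} → Z v → c ≤ v → b ≤ c′ → c′ ≤ suc e →
    (∀ {x y} → b ≤ x → x < c′ → c′ < y → y ≤ suc e → (x ≤ v × suc v < y) ⊎ (unbump v x < c × c < unbump v y)) →
    (∀ {x y} → y ≤ suc e → (x ≤ v × suc v < y) ⊎ (unbump v x < c × c < unbump v y) → x < c′ × c′ < y) →
    (∀ {x} → Z′ x → v < x) → (∀ {x} → v ≤ x → Z′ (suc x) → Z x) →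
    (∀ {x} → v ≤ x → x ≤ e → Z x → Z′ (suc x)) →
    Window (suc n) b c′ (suc e) Z′ (insert v τ)
  insert-keeping {Z′} {c′} Zv c≤v b≤c′ c′≤e window⇒ ⇒window Z′-high Z′⇒Z Z⇒Z′ = record
    { perm   = Perm-insert v≤n perm
    ; b≤c    = b≤c′
    ; c≤e    = c′≤e
    ; e≤n    = s≤s e≤n
    ; asc⁺   = asc⁺′
    ; asc⁻   = asc⁻′
    ; inv⁺   = inv⁺′
    ; inv⁻   = inv⁻′
    ; below⁺ = Below.below⁺′ v≤e ≤-refl none some
    ; below⁻ = Below.below⁻′ v≤e ≤-refl none some
    ; above⁺ = λ x<b → 231Above-insert⁺ v τ (inj₂ (above⁺
        (subst (_< b) (sym (unbump-low (<⇒≤ (<-≤-trans x<b b≤v)))) x<b)))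
    ; above⁻ = above⁻′
    ; no4123 = no4123′
    ; no1342 = no1342′
    }
    where
    none : ∀ {y} → y ≤ e → ¬ Asc v y τ
    none y≤e h = <⇒≱ (proj₁ (asc⁻ b≤v y≤e h)) c≤v

    some : ∀ {y} → e < y → y ≤ n → Asc v y τ ⊎ 123Below y τ
    some e<y y≤n = inj₂ (below⁺ e<y y≤n)

    asc⁺′ : ∀ {x y} → b ≤ x → x < c′ → c′ < y → y ≤ suc e → Asc x y (insert v τ)
    asc⁺′ {x} {y} b≤x x<c c<y y≤e with window⇒ b≤x x<c c<y y≤e
    ... | inj₁ (x≤v , v<y) = Asc-insert-new v τ x≤v v<y (Perm.full perm (≤-trans (s≤s⁻¹ (≤-trans v<y y≤e)) e≤n))
    ... | inj₂ (p , q) = Asc-insert⁺ v τ (asc⁺ (≤-unbump x b≤v b≤x) p q (unbump-≤-suc y v≤e y≤e))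

    asc⁻′ : ∀ {x y} → b ≤ x → y ≤ suc e → Asc x y (insert v τ) → x < c′ × c′ < y
    asc⁻′ {x} {y} b≤x y≤e h with Asc-insert⁻ v τ h
    ... | inj₁ p = ⇒window y≤e (inj₁ p)
    ... | inj₂ p = ⇒window y≤e (inj₂ (asc⁻ (≤-unbump x b≤v b≤x) (unbump-≤-suc y v≤e y≤e) p))

    inv⁺′ : ∀ {x y} → b ≤ y → y < x → x ≤ suc e → ¬ Z′ x → Inv x y (insert v τ)
    inv⁺′ {x} {y} b≤y y<x x≤e ¬Z′x with split v x
    -- At sites up to v the new first entry itself gives the inversion, so no exceptional site
    -- survives there.
    ... | low x≤v _ = Inv-insert-new v τ x≤v y<x (Perm.full perm (<-≤-trans y<x (≤-trans x≤v v≤n)))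
    ... | high {x′} v≤x eq = Inv-insert⁺ v τ (subst (λ u → Inv u (unbump v y) τ) (sym eq)
      (inv⁺ (≤-unbump y b≤v b≤y) below-x (s≤s⁻¹ x≤e) ¬Zx))
      where
      ¬Zx : ¬ Z x′
      ¬Zx Zx = ¬Z′x (Z⇒Z′ v≤x (s≤s⁻¹ x≤e) Zx)
      v<x : v < x′
      v<x = ≤∧≢⇒< v≤x λ { refl → ¬Zx Zv }
      below-x : unbump v y < x′
      below-x with split v y
      ... | low y≤v eq′ = subst (_< x′) (sym eq′) (≤-<-trans y≤v v<x)
      ... | high _ eq′  = subst (_< x′) (sym eq′) (s≤s⁻¹ y<x)

    inv⁻′ : ∀ {x y} → b ≤ y → x ≤ suc e → Inv x y (insert v τ) → ¬ Z′ x
    inv⁻′ {x} {y} b≤y x≤e h Z′x with split v x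
    ... | low x≤v _ = <⇒≱ (Z′-high Z′x) x≤v
    ... | high v≤x eq with Inv-insert⁻ v τ h
    ...   | inj₁ (x≤v , _) = <⇒≱ x≤v v≤x
    ...   | inj₂ p = inv⁻ (≤-unbump y b≤v b≤y) (s≤s⁻¹ x≤e)
                       (subst (λ u → Inv u (unbump v y) τ) eq p) (Z′⇒Z v≤x Z′x)

    above⁻′ : ∀ {x} → 231Above x (insert v τ) → x < b
    above⁻′ {x} h with 231Above-insert⁻ v τ h
    ... | inj₂ p = unbump-<-cancel x b≤v (above⁻ p)
    -- With v as its 2, a 231 inside the window needs an inversion across v, which `Zv` excludes.
    ... | inj₁ p = unbump-<-cancel x b≤v (≰⇒> λ b≤u → inv⁻ b≤u v≤e p Zv)

-- The generating tree

-- l is the distance from the start b of the window to c.  The end e of the window is c + m for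
-- G l m, c + suc m for H l m and c + suc m for K l m; the exceptional sites Z are {c}, {c, e}
-- and {e} respectively.
data State : Set where
  G H K : ℕ → ℕ → State

-- Cutting at v restarts the window at v with c = `suc v`, hence the first parameter 1. The cut
-- window ends at `suc c` if v is below c, and at `suc e` otherwise. It has shape `H` if that c or e
-- was exceptional and shape `G` if not: c is exceptional in `G` and `H`, e in `H` and `K`. At the
-- exceptional sites themselves nothing is cut and one parameter grows.
children : State → List State
children (G l m) = applyDownFrom (H 1) l ++ G (suc l) m ∷ applyDownFrom (G 1) m
children (H l m) = applyDownFrom (H 1) l ++ H (suc l) m ∷ applyDownFrom (H 1) m ++ K l (suc m) ∷ []
children (K l s) = applyDownFrom (λ d → G 1 (suc d)) l ++ applyDownFrom (H 1) (suc s) ++ K l (suc s) ∷ []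

descendants : ℕ → State → ℕ
descendants zero    s = 1
descendants (suc n) s = sum (map (descendants n) (children s))

module _ {n b c e Z τ} (W : Window n b c e Z τ) {v} (b≤v : b ≤ v) (v≤e : v ≤ e) where
  open Window W

  -- Ascents of the window have their bottoms below c and their tops at c or above. Hence `e₀` is c
  -- when v lies below c, and e when no ascent of the window starts at v or higher.
  record Ceiling (e₀ : ℕ) : Set where
    field
      v≤e₀ : v ≤ e₀
      e₀≤e : e₀ ≤ e
      none : ∀ {y} → y ≤ e₀ → ¬ Asc v y τ
      some : ∀ {y} → e₀ < y → y ≤ e → Asc v y τ

  ceiling-low : v < c → Ceiling c
  ceiling-low v<c = record
    { v≤e₀ = <⇒≤ v<c
    ; e₀≤e = c≤e
    ; none = λ y≤c h → <⇒≱ (proj₂ (asc⁻ b≤v (≤-trans y≤c c≤e) h)) y≤c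
    ; some = asc⁺ b≤v v<c
    }

  ceiling-high : c ≤ v → Ceiling e
  ceiling-high c≤v = record
    { v≤e₀ = v≤e
    ; e₀≤e = ≤-refl
    ; none = λ y≤e h → <⇒≱ (proj₁ (asc⁻ b≤v y≤e h)) c≤v
    ; some = λ e<y y≤e → ⊥-elim (<⇒≱ e<y y≤e)
    }

  -- A cut always makes `suc v` exceptional and moves the old exceptional sites between v and `e₀`
  -- up by one. If there is none, shape `G` results; if `e₀` is the only one, shape `H`.
  cut-G : ∀ {e₀} → ¬ Z v → Ceiling e₀ → (∀ {x} → v < x → x ≤ e₀ → ¬ Z x) →
    Window (suc n) v (suc v) (suc e₀) (_≡ suc v) (insert v τ)
  cut-G ¬Zv C ¬Z = insert-cutting W b≤v v≤e ¬Zv v≤e₀ e₀≤e none some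
    (λ { v<x refl → ⊥-elim (<-irrefl refl v<x) }) (λ v<x x≤ Zx → ⊥-elim (¬Z v<x x≤ Zx)) refl
    where open Ceiling C

  cut-H : ∀ {e₀} → ¬ Z v → Ceiling e₀ → Z e₀ → (∀ {x} → v < x → x ≤ e₀ → Z x → x ≡ e₀) →
    Window (suc n) v (suc v) (suc e₀) (λ x → x ≡ suc v ⊎ x ≡ suc e₀) (insert v τ)
  cut-H ¬Zv C Ze₀ Z≡ = insert-cutting W b≤v v≤e ¬Zv v≤e₀ e₀≤e none some
    (λ { v<x (inj₁ refl) → ⊥-elim (<-irrefl refl v<x) ; v<x (inj₂ refl) → Ze₀ })
    (λ v<x x≤ Zx → inj₂ (cong suc (Z≡ v<x x≤ Zx))) (inj₁ refl)
    where open Ceiling C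

module _ {n b c e Z τ} (W : Window n b c e Z τ) where
  open Window W

  -- The new entry c starts an ascent to every larger window value, so bottoms up to c become
  -- possible, while the old value c, the lowest top so far, is bumped to `suc c`.
  keep-c : ∀ {Z′} → Z c → (∀ {x} → Z′ x → c < x) → (∀ {x} → c ≤ x → Z′ (suc x) → Z x) →
    (∀ {x} → c ≤ x → x ≤ e → Z x → Z′ (suc x)) → Window (suc n) b (suc c) (suc e) Z′ (insert c τ)
  keep-c Zc = insert-keeping W b≤c c≤e Zc ≤-refl (≤-trans b≤c (n≤1+n c)) (s≤s c≤e)
    (λ _ x<1+c c<y _ → inj₁ (s≤s⁻¹ x<1+c , c<y))
    (λ { _ (inj₁ (x≤c , c<y)) → s≤s x≤c , c<y
       ; {x} {y} _ (inj₂ (p , q)) → m<n⇒m<1+n (unbump-<-cancel x ≤-refl p) , suc-<-unbump y ≤-refl q })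

  -- The new entry e is the largest value of the enlarged window and starts no ascent in it, so c
  -- stays. It precedes all smaller window values, which leaves only the exceptional site moved from
  -- e to `suc e`.
  keep-e : c < e → Z e → (∀ {x} → e ≤ x → Z x → x ≡ e) →
    Window (suc n) b c (suc e) (_≡ suc e) (insert e τ)
  keep-e c<e Ze Z≡ = insert-keeping W (≤-trans b≤c c≤e) ≤-refl Ze c≤e b≤c (≤-trans c≤e (n≤1+n e))
    window⇒ ⇒window (λ { refl → ≤-refl }) (λ { _ refl → Ze }) (λ e≤x _ Zx → cong suc (Z≡ e≤x Zx))
    where
    window⇒ : ∀ {x y} → b ≤ x → x < c → c < y → y ≤ suc e →
      (x ≤ e × suc e < y) ⊎ (unbump e x < c × c < unbump e y)
    window⇒ {x} {y} _ x<c c<y _ = inj₂ (subst (_< c) (sym (unbump-low (<⇒≤ (<-trans x<c c<e)))) x<c , c<u)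
      where
      c<u : c < unbump e y
      c<u with split e y
      ... | low _ eq    = subst (c <_) (sym eq) c<y
      ... | high e≤z eq = subst (c <_) (sym eq) (<-≤-trans c<e e≤z)
    ⇒window : ∀ {x y} → y ≤ suc e →
      (x ≤ e × suc e < y) ⊎ (unbump e x < c × c < unbump e y) → x < c × c < y
    ⇒window y≤ (inj₁ (_ , p)) = ⊥-elim (<⇒≱ p y≤)
    ⇒window {x} {y} _ (inj₂ (p , q)) =
      unbump-<-cancel x c≤e p , c<y
      where
      c<y : c < y
      c<y with split e y
      ... | low _ eq  = subst (c <_) eq q
      ... | high _ eq = m<n⇒m<1+n (subst (c <_) eq q)

-- States as shapes of windows, and the validity of their children

Represents : State → ℕ → ℕ → List ℕ → Set
Represents (G l m) b n = Window n b (b + l) (b + l + m) (_≡ b + l)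
Represents (H l m) b n = Window n b (b + l) (b + l + suc m) (λ x → x ≡ b + l ⊎ x ≡ b + l + suc m)
Represents (K l s) b n = Window n b (b + l) (b + l + suc s) (_≡ b + l + suc s)

-- The ends produced by an insertion agree with the sums in `Represents` only propositionally.
-- Taking them as variables with equations lets `refl` do the rewriting without transports.
toG : ∀ {n b c e l m τ} → c ≡ b + l → e ≡ c + m → Window n b c e (_≡ c) τ → Represents (G l m) b n τ
toG refl refl W = W

toH : ∀ {n b c e l m τ} → c ≡ b + l → e ≡ c + suc m →
  Window n b c e (λ x → x ≡ c ⊎ x ≡ e) τ → Represents (H l m) b n τ
toH refl refl W = W

toK : ∀ {n b c e l s τ} → c ≡ b + l → e ≡ c + suc s → Window n b c e (_≡ e) τ → Represents (K l s) b n τ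
toK refl refl W = W

record Node : Set where
  constructor node
  field
    state  : State
    offset : ℕ
    word   : List ℕ
open Node

-- The site v′ of the run gets the state f d with v′ + suc d = v + k.
run : (ℕ → State) → ℕ → ℕ → List ℕ → List Node
run f v zero    τ = []
run f v (suc k) τ = node (f k) v (insert v τ) ∷ run f (suc v) k τ

childNodes : Node → List Node
childNodes (node (G l m) b τ) =
  run (H 1) b l τ ++ node (G (suc l) m) b (insert (b + l) τ) ∷ run (G 1) (suc (b + l)) m τ
childNodes (node (H l m) b τ) =
  run (H 1) b l τ ++ node (H (suc l) m) b (insert (b + l) τ) ∷
  run (H 1) (suc (b + l)) m τ ++ node (K l (suc m)) b (insert (b + l + suc m) τ) ∷ []
childNodes (node (K l s) b τ) =
  run (λ d → G 1 (suc d)) b l τ ++ run (H 1) (b + l) (suc s) τ ++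
  node (K l (suc s)) b (insert (b + l + suc s) τ) ∷ []

Valid : ℕ → Node → Set
Valid n (node s b τ) = Represents s b n τ

run-All : ∀ {P : Node → Set} f v k τ →
  (∀ {v′ d} → v ≤ v′ → v′ + suc d ≡ v + k → P (node (f d) v′ (insert v′ τ))) → All P (run f v k τ)
run-All f v zero    τ p = []
run-All f v (suc k) τ p =
  p ≤-refl refl ∷ run-All f (suc v) k τ λ v<v′ eq → p (<⇒≤ v<v′) (trans eq (sym (+-suc v k)))

module _ {v d x : ℕ} (eq : v + suc d ≡ x) where

  run-< : v < x
  run-< = subst (v <_) eq (m<m+n v z<s)

  run-suc : suc x ≡ suc v + suc d
  run-suc = cong suc (sym eq)

suc≡+1 : ∀ v → suc v ≡ v + 1
suc≡+1 v = +-comm 1 v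

childNodes-valid : ∀ {n} nd → Valid n nd → All (Valid (suc n)) (childNodes nd)
childNodes-valid {n} (node (G l m) b τ) W = All.++⁺ (run-All (H 1) b l τ low-child)
  (toG (sym (+-suc b l)) refl (keep-c W refl (λ { refl → ≤-refl }) (λ { _ refl → refl }) (λ { _ _ refl → refl }))
   ∷ run-All (G 1) (suc (b + l)) m τ high-child)
  where
  c = b + l
  e = c + m
  low-child : ∀ {v d} → b ≤ v → v + suc d ≡ c → Represents (H 1 d) v (suc n) (insert v τ)
  low-child {v} b≤v eq = toH (suc≡+1 v) (run-suc eq)
    (cut-H W b≤v v≤e (<⇒≢ (run-< eq)) (ceiling-low W b≤v v≤e (run-< eq)) refl (λ _ _ p → p))
    where v≤e = ≤-trans (<⇒≤ (run-< eq)) (m≤m+n c m)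
  high-child : ∀ {v d} → suc c ≤ v → v + suc d ≡ suc c + m → Represents (G 1 d) v (suc n) (insert v τ)
  high-child {v} {d} c<v eq = toG (suc≡+1 v) (trans (sym eq) (+-suc v d))
    (cut-G W b≤v v≤e (λ { refl → <-irrefl refl c<v }) (ceiling-high W b≤v v≤e (<⇒≤ c<v))
      (λ { v<x _ refl → <-asym v<x c<v }))
    where
    v≤e = s≤s⁻¹ (run-< eq)
    b≤v = ≤-trans (m≤m+n b l) (<⇒≤ c<v)
childNodes-valid {n} (node (H l m) b τ) W = All.++⁺ (run-All (H 1) b l τ low-child)
  (toH (sym (+-suc b l)) refl (keep-c W (inj₁ refl)
    (λ { (inj₁ refl) → ≤-refl ; (inj₂ refl) → m<n⇒m<1+n c<e })
    (λ { _ (inj₁ refl) → inj₁ refl ; _ (inj₂ refl) → inj₂ refl })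
    (λ { _ _ (inj₁ refl) → inj₁ refl ; _ _ (inj₂ refl) → inj₂ refl }))
   ∷ All.++⁺ (run-All (H 1) (suc (b + l)) m τ high-child)
   (toK refl (sym (+-suc c (suc m))) (keep-e W c<e (inj₂ refl)
     λ { e≤x (inj₁ refl) → ⊥-elim (<⇒≱ c<e e≤x) ; _ (inj₂ p) → p }) ∷ []))
  where
  c = b + l
  e = c + suc m
  c<e : c < e
  c<e = m<m+n c z<s
  low-child : ∀ {v d} → b ≤ v → v + suc d ≡ c → Represents (H 1 d) v (suc n) (insert v τ)
  low-child {v} b≤v eq = toH (suc≡+1 v) (run-suc eq)
    (cut-H W b≤v v≤e
      (λ { (inj₁ p) → <⇒≢ v<c p ; (inj₂ p) → <⇒≢ (<-trans v<c c<e) p })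
      (ceiling-low W b≤v v≤e v<c) (inj₁ refl)
      (λ { _ _ (inj₁ p) → p ; _ x≤c (inj₂ refl) → ⊥-elim (<⇒≱ c<e x≤c) }))
    where
    v<c = run-< eq
    v≤e = <⇒≤ (<-trans v<c c<e)
  high-child : ∀ {v d} → suc c ≤ v → v + suc d ≡ suc c + m → Represents (H 1 d) v (suc n) (insert v τ)
  high-child {v} c<v eq = toH (suc≡+1 v) (run-suc eq′)
    (cut-H W b≤v v≤e
      (λ { (inj₁ refl) → <-irrefl refl c<v ; (inj₂ p) → <⇒≢ v<e p })
      (ceiling-high W b≤v v≤e (<⇒≤ c<v)) (inj₂ refl)
      (λ { v<x _ (inj₁ refl) → ⊥-elim (<-asym v<x c<v) ; _ _ (inj₂ p) → p }))
    where
    eq′ = trans eq (sym (+-suc c m))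
    v<e = run-< eq′
    v≤e = <⇒≤ v<e
    b≤v = ≤-trans (m≤m+n b l) (<⇒≤ c<v)
childNodes-valid {n} (node (K l s) b τ) W = All.++⁺ (run-All (λ d → G 1 (suc d)) b l τ low-child)
  (All.++⁺ (run-All (H 1) (b + l) (suc s) τ high-child)
   (toK refl (sym (+-suc c (suc s))) (keep-e W c<e refl (λ _ p → p)) ∷ []))
  where
  c = b + l
  e = c + suc s
  c<e : c < e
  c<e = m<m+n c z<s
  low-child : ∀ {v d} → b ≤ v → v + suc d ≡ c → Represents (G 1 (suc d)) v (suc n) (insert v τ)
  low-child {v} b≤v eq = toG (suc≡+1 v) (run-suc eq)
    (cut-G W b≤v v≤e (<⇒≢ (<-trans v<c c<e)) (ceiling-low W b≤v v≤e v<c)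
      (λ { _ x≤c refl → <⇒≱ c<e x≤c }))
    where
    v<c = run-< eq
    v≤e = <⇒≤ (<-trans v<c c<e)
  high-child : ∀ {v d} → c ≤ v → v + suc d ≡ e → Represents (H 1 d) v (suc n) (insert v τ)
  high-child {v} c≤v eq = toH (suc≡+1 v) (run-suc eq)
    (cut-H W b≤v v≤e (<⇒≢ v<e) (ceiling-high W b≤v v≤e c≤v) refl (λ _ _ p → p))
    where
    v<e = run-< eq
    v≤e = <⇒≤ v<e
    b≤v = ≤-trans (m≤m+n b l) c≤v

-- The sites of a window in increasing order

range : ℕ → ℕ → List ℕ
range v zero    = []
range v (suc k) = v ∷ range (suc v) k

range-++ : ∀ v j k → range v j ++ range (v + j) k ≡ range v (j + k)
range-++ v zero    k = cong (λ u → range u k) (+-identityʳ v)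
range-++ v (suc j) k = cong (v ∷_) (trans (cong (λ u → range (suc v) j ++ range u k) (+-suc v j)) (range-++ (suc v) j k))

∈-range⁺ : ∀ {w} v k → v ≤ w → w < v + k → w ∈ range v k
∈-range⁺ {w} v zero    v≤w w< = ⊥-elim (<⇒≱ w< (subst (_≤ w) (sym (+-identityʳ v)) v≤w))
∈-range⁺ {w} v (suc k) v≤w w< with m≤n⇒m<n∨m≡n v≤w
... | inj₁ v<w  = there (∈-range⁺ (suc v) k v<w (subst (w <_) (+-suc v k) w<))
... | inj₂ refl = here refl

range-≥ : ∀ v k → All (v ≤_) (range v k)
range-≥ v zero    = []
range-≥ v (suc k) = ≤-refl ∷ All.map <⇒≤ (range-≥ (suc v) k)

range-unique : ∀ v k → Unique (range v k)
range-unique v zero    = []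
range-unique v (suc k) = All.map <⇒≢ (range-≥ (suc v) k) ∷ range-unique (suc v) k

inserts : List ℕ → ℕ → ℕ → List (List ℕ)
inserts τ v k = map (λ w → insert w τ) (range v k)

inserts-++ : ∀ τ v j k → inserts τ v j ++ inserts τ (v + j) k ≡ inserts τ v (j + k)
inserts-++ τ v j k = trans (sym (map-++ _ (range v j) (range (v + j) k))) (cong (map _) (range-++ v j k))

run-words : ∀ f v k τ → map word (run f v k τ) ≡ inserts τ v k
run-words f v zero    τ = refl
run-words f v (suc k) τ = cong (insert v τ ∷_) (run-words f (suc v) k τ)

run-states : ∀ f v k τ → map state (run f v k τ) ≡ applyDownFrom f k
run-states f v zero    τ = refl
run-states f v (suc k) τ = cong (f k ∷_) (run-states f (suc v) k τ)

size : State → ℕ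
size (G l m) = l + m
size (H l m) = l + suc m
size (K l s) = l + suc s

-- The runs and the single sites between them are adjacent, so each site of the window is used
-- exactly once. Distinctness of siblings and completeness of the tree both rest on this.
childNodes-words : ∀ nd → map word (childNodes nd) ≡ inserts (word nd) (offset nd) (suc (size (state nd)))
childNodes-words (node (G l m) b τ) = begin
  map word (run (H 1) b l τ ++ _)
    ≡⟨ map-++ word (run (H 1) b l τ) _ ⟩
  map word (run (H 1) b l τ) ++ insert (b + l) τ ∷ map word (run (G 1) (suc (b + l)) m τ)
    ≡⟨ cong₂ (λ xs ys → xs ++ insert (b + l) τ ∷ ys) (run-words (H 1) b l τ) (run-words (G 1) (suc (b + l)) m τ) ⟩
  inserts τ b l ++ inserts τ (b + l) (suc m)
    ≡⟨ inserts-++ τ b l (suc m) ⟩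
  inserts τ b (l + suc m)
    ≡⟨ cong (inserts τ b) (+-suc l m) ⟩
  inserts τ b (suc (l + m)) ∎
  where open ≡-Reasoning
childNodes-words (node (H l m) b τ) = begin
  map word (run (H 1) b l τ ++ _)
    ≡⟨ map-++ word (run (H 1) b l τ) _ ⟩
  map word (run (H 1) b l τ) ++ insert (b + l) τ ∷ map word (run (H 1) (suc (b + l)) m τ ++ _)
    ≡⟨ cong₂ (λ xs ys → xs ++ insert (b + l) τ ∷ ys) (run-words (H 1) b l τ)
        (trans (map-++ word (run (H 1) (suc (b + l)) m τ) _)
               (cong (_++ insert (b + l + suc m) τ ∷ []) (run-words (H 1) (suc (b + l)) m τ))) ⟩
  inserts τ b l ++ (inserts τ (b + l) (suc m) ++ inserts τ (b + l + suc m) 1)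
    ≡⟨ cong (inserts τ b l ++_) (inserts-++ τ (b + l) (suc m) 1) ⟩
  inserts τ b l ++ inserts τ (b + l) (suc m + 1)
    ≡⟨ inserts-++ τ b l (suc m + 1) ⟩
  inserts τ b (l + (suc m + 1))
    ≡⟨ cong (inserts τ b) (trans (sym (+-assoc l (suc m) 1)) (+-comm (l + suc m) 1)) ⟩
  inserts τ b (suc (l + suc m)) ∎
  where open ≡-Reasoning
childNodes-words (node (K l s) b τ) = begin
  map word (run (λ d → G 1 (suc d)) b l τ ++ _)
    ≡⟨ map-++ word (run (λ d → G 1 (suc d)) b l τ) _ ⟩
  map word (run (λ d → G 1 (suc d)) b l τ) ++ map word (run (H 1) (b + l) (suc s) τ ++ _)
    ≡⟨ cong₂ _++_ (run-words (λ d → G 1 (suc d)) b l τ)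
        (trans (map-++ word (run (H 1) (b + l) (suc s) τ) _)
               (cong (_++ insert (b + l + suc s) τ ∷ []) (run-words (H 1) (b + l) (suc s) τ))) ⟩
  inserts τ b l ++ (inserts τ (b + l) (suc s) ++ inserts τ (b + l + suc s) 1)
    ≡⟨ cong (inserts τ b l ++_) (inserts-++ τ (b + l) (suc s) 1) ⟩
  inserts τ b l ++ inserts τ (b + l) (suc s + 1)
    ≡⟨ inserts-++ τ b l (suc s + 1) ⟩
  inserts τ b (l + (suc s + 1))
    ≡⟨ cong (inserts τ b) (trans (sym (+-assoc l (suc s) 1)) (+-comm (l + suc s) 1)) ⟩
  inserts τ b (suc (l + suc s)) ∎
  where open ≡-Reasoning

childNodes-states : ∀ nd → map state (childNodes nd) ≡ children (state nd)
childNodes-states (node (G l m) b τ) = trans (map-++ state (run (H 1) b l τ) _)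
  (cong₂ (λ xs ys → xs ++ G (suc l) m ∷ ys) (run-states (H 1) b l τ) (run-states (G 1) (suc (b + l)) m τ))
childNodes-states (node (H l m) b τ) = trans (map-++ state (run (H 1) b l τ) _)
  (cong₂ (λ xs ys → xs ++ H (suc l) m ∷ ys) (run-states (H 1) b l τ)
    (trans (map-++ state (run (H 1) (suc (b + l)) m τ) _)
           (cong (_++ K l (suc m) ∷ []) (run-states (H 1) (suc (b + l)) m τ))))
childNodes-states (node (K l s) b τ) = trans (map-++ state (run (λ d → G 1 (suc d)) b l τ) _)
  (cong₂ _++_ (run-states (λ d → G 1 (suc d)) b l τ)
    (trans (map-++ state (run (H 1) (b + l) (suc s) τ) _)
           (cong (_++ K l (suc s) ∷ []) (run-states (H 1) (b + l) (suc s) τ))))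

-- Generations of the tree and their sizes

generation : ℕ → List Node
generation zero    = node (G 0 0) 0 [] ∷ []
generation (suc n) = concatMap childNodes (generation n)

totalDescendants : ℕ → List Node → ℕ
totalDescendants k nds = sum (map (λ nd → descendants k (state nd)) nds)

totalDescendants-++ : ∀ k nds nds′ →
  totalDescendants k (nds ++ nds′) ≡ totalDescendants k nds + totalDescendants k nds′
totalDescendants-++ k nds nds′ = trans (cong sum (map-++ _ nds nds′)) (sum-++ (map _ nds) (map _ nds′))

totalDescendants-childNodes : ∀ k nd → totalDescendants k (childNodes nd) ≡ descendants (suc k) (state nd)
totalDescendants-childNodes k nd = cong sum
  (trans (map-∘ (childNodes nd)) (cong (map (descendants k)) (childNodes-states nd)))

totalDescendants-suc : ∀ k nds → totalDescendants k (concatMap childNodes nds) ≡ totalDescendants (suc k) nds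
totalDescendants-suc k []         = refl
totalDescendants-suc k (nd ∷ nds) = trans (totalDescendants-++ k (childNodes nd) (concatMap childNodes nds))
  (cong₂ _+_ (totalDescendants-childNodes k nd) (totalDescendants-suc k nds))

-- Expanding one level trades a unit of k for a unit of n, so the total depends only on n + k.
totalDescendants-generation : ∀ n k → totalDescendants k (generation n) ≡ descendants (n + k) (G 0 0)
totalDescendants-generation zero    k = +-identityʳ _
totalDescendants-generation (suc n) k = trans (totalDescendants-suc k (generation n))
  (trans (totalDescendants-generation n (suc k)) (cong (λ i → descendants i (G 0 0)) (+-suc n k)))

totalDescendants-zero : ∀ nds → totalDescendants 0 nds ≡ length nds
totalDescendants-zero []         = refl
totalDescendants-zero (nd ∷ nds) = cong suc (totalDescendants-zero nds)

length-generation : ∀ n → length (generation n) ≡ descendants n (G 0 0)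
length-generation n = trans (sym (totalDescendants-zero (generation n)))
  (trans (totalDescendants-generation n 0) (cong (λ i → descendants i (G 0 0)) (+-identityʳ n)))

root-valid : Valid 0 (node (G 0 0) 0 [])
root-valid = record
  { perm   = record { len = refl ; bounded = [] ; unique = [] ; full = λ () }
  ; b≤c    = z≤n
  ; c≤e    = z≤n
  ; e≤n    = z≤n
  ; asc⁺   = λ _ ()
  ; asc⁻   = λ { _ _ (_ , _ , () , _) }
  ; inv⁺   = λ { _ y<x z≤n _ → ⊥-elim (n≮0 y<x) }
  ; inv⁻   = λ { _ _ (_ , _ , () , _) }
  ; below⁺ = λ { () z≤n }
  ; below⁻ = λ { (_ , _ , _ , () , _) }
  ; above⁺ = λ ()
  ; above⁻ = λ { (_ , _ , _ , () , _) }
  ; no4123 = λ { (_ , _ , _ , _ , () , _) }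
  ; no1342 = λ { (_ , _ , _ , _ , () , _) }
  }

generation-valid : ∀ n → All (Valid n) (generation n)
generation-valid zero    = root-valid ∷ []
generation-valid (suc n) = All.concat⁺ (All.map⁺ (All.map (λ {nd} → childNodes-valid nd) (generation-valid n)))

-- Generations consist of exactly the avoiding permutations

record Avoider (n : ℕ) (σ : List ℕ) : Set where
  field
    len     : length σ ≡ n
    bounded : All (_< n) σ
    unique  : Unique σ
    no4123  : ¬ Has4123 σ
    no1342  : ¬ Has1342 σ

window-avoider : ∀ {n b c e Z τ} → Window n b c e Z τ → Avoider n τ
window-avoider W = record { Window W ; Perm (Window.perm W) }

window-site : ∀ {n b c e Z τ v} → Window n b c e Z τ → v ≤ n →
  ¬ Has4123 (insert v τ) → ¬ Has1342 (insert v τ) → b ≤ v × v ≤ e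
window-site {τ = τ} {v} W v≤n no4123 no1342 =
  (≮⇒≥ λ v<b → no1342 (Has1342-insert⁺ v τ (inj₁ (above⁺ v<b)))) ,
  (≮⇒≥ λ e<v → no4123 (Has4123-insert⁺ v τ (inj₁ (below⁺ e<v v≤n))))
  where open Window W using (above⁺; below⁺)

valid-avoider : ∀ {n} nd → Valid n nd → Avoider n (word nd)
valid-avoider (node (G _ _) _ _) = window-avoider
valid-avoider (node (H _ _) _ _) = window-avoider
valid-avoider (node (K _ _) _ _) = window-avoider

valid-site : ∀ {n v} nd → Valid n nd → v ≤ n → ¬ Has4123 (insert v (word nd)) → ¬ Has1342 (insert v (word nd)) →
  offset nd ≤ v × v ≤ offset nd + size (state nd)
valid-site {v = v} (node (G l m) b τ) W v≤n p q =
  subst (λ e → b ≤ v × v ≤ e) (+-assoc b l m) (window-site W v≤n p q)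
valid-site {v = v} (node (H l m) b τ) W v≤n p q =
  subst (λ e → b ≤ v × v ≤ e) (+-assoc b l (suc m)) (window-site W v≤n p q)
valid-site {v = v} (node (K l s) b τ) W v≤n p q =
  subst (λ e → b ≤ v × v ≤ e) (+-assoc b l (suc s)) (window-site W v≤n p q)

parent : List ℕ → List ℕ
parent []      = []
parent (v ∷ ρ) = map (unbump v) ρ

parent-insert : ∀ v τ → parent (insert v τ) ≡ τ
parent-insert v τ = trans (sym (map-∘ τ)) (trans (map-cong (unbump-bump v) τ) (map-id τ))

parent-childNodes : ∀ nd {σ} → σ ∈ map word (childNodes nd) → parent σ ≡ word nd
parent-childNodes nd σ∈ with ∈-map⁻ _ (subst (_ ∈_) (childNodes-words nd) σ∈)
... | v , _ , refl = parent-insert v (word nd)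

concatMap-childNodes⁻ : ∀ nds {σ} → σ ∈ map word (concatMap childNodes nds) →
  ∃[ nd ] nd ∈ nds × σ ∈ map word (childNodes nd)
concatMap-childNodes⁻ (nd ∷ nds) σ∈
  with ∈-++⁻ (map word (childNodes nd)) (subst (_ ∈_) (map-++ word (childNodes nd) (concatMap childNodes nds)) σ∈)
... | inj₁ p = nd , here refl , p
... | inj₂ p with concatMap-childNodes⁻ nds p
...   | nd′ , q , r = nd′ , there q , r

concatMap-childNodes⁺ : ∀ {nd} nds {σ} → nd ∈ nds → σ ∈ map word (childNodes nd) →
  σ ∈ map word (concatMap childNodes nds)
concatMap-childNodes⁺ (nd ∷ nds) (here refl) p =
  subst (_ ∈_) (sym (map-++ word (childNodes nd) (concatMap childNodes nds))) (∈-++⁺ˡ p)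
concatMap-childNodes⁺ (nd ∷ nds) (there q) p =
  subst (_ ∈_) (sym (map-++ word (childNodes nd) (concatMap childNodes nds)))
    (∈-++⁺ʳ (map word (childNodes nd)) (concatMap-childNodes⁺ nds q p))

-- Siblings differ in their first entry, and children of different nodes differ because `parent`
-- recovers the word of the node.
concatMap-childNodes-unique : ∀ nds → Unique (map word nds) → Unique (map word (concatMap childNodes nds))
concatMap-childNodes-unique []         u       = []
concatMap-childNodes-unique (nd ∷ nds) (h ∷ u) =
  subst Unique (sym (map-++ word (childNodes nd) (concatMap childNodes nds)))
    (Unique.++⁺ (subst Unique (sym (childNodes-words nd)) (Unique.map⁺ ∷-injectiveˡ (range-unique _ _)))
                (concatMap-childNodes-unique nds u) disjoint)
  where
  disjoint : Disjoint (map word (childNodes nd)) (map word (concatMap childNodes nds))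
  disjoint (p , q) with concatMap-childNodes⁻ nds q
  ... | nd′ , nd′∈ , r = All.lookup h (∈-map⁺ word nd′∈)
    (trans (sym (parent-childNodes nd p)) (parent-childNodes nd′ r))

generation-unique : ∀ n → Unique (map word (generation n))
generation-unique zero    = [] ∷ []
generation-unique (suc n) = concatMap-childNodes-unique (generation n) (generation-unique n)

insert-parent : ∀ v ρ → All (v ≢_) ρ → insert v (map (unbump v) ρ) ≡ v ∷ ρ
insert-parent v ρ v∉ρ = cong (v ∷_) (go ρ v∉ρ)
  where
  go : ∀ ρ → All (v ≢_) ρ → map (bump v) (map (unbump v) ρ) ≡ ρ
  go []      []        = refl
  go (w ∷ ρ) (v≢w ∷ h) = cong₂ _∷_ (bump-unbump v w (v≢w ∘ sym)) (go ρ h)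

-- Deleting the first entry and closing the gap preserves avoidance, so the rest is the word of a
-- node by induction. Avoidance of the whole word then forces v into the window of that node.
generation-complete : ∀ n {σ} → Avoider n σ → σ ∈ map word (generation n)
generation-complete zero    {[]} A = here refl
generation-complete (suc n) {v ∷ ρ} A with Avoider.unique A | Avoider.bounded A
... | v∉ρ ∷ u | s≤s v≤n ∷ ρ<n = found (∈-map⁻ word (generation-complete n {τ} avoider-τ))
  where
  τ = map (unbump v) ρ
  σ≡ : insert v τ ≡ v ∷ ρ
  σ≡ = insert-parent v ρ v∉ρ
  no4123 : ¬ Has4123 (insert v τ)
  no4123 h = Avoider.no4123 A (subst Has4123 σ≡ h)
  no1342 : ¬ Has1342 (insert v τ)
  no1342 h = Avoider.no1342 A (subst Has1342 σ≡ h)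
  bounded-τ : All (λ w → unbump v w < n) ρ
  bounded-τ = All.zipWith (λ {w} (v≢w , w<n) → subst (unbump v w <_) (unbump-high v≤n)
      (<-unbump v (subst (_< suc n) (sym (bump-unbump v w (v≢w ∘ sym))) w<n))) (v∉ρ , ρ<n)
  avoider-τ : Avoider n τ
  avoider-τ = record
    { len     = trans (length-map (unbump v) ρ) (suc-injective (Avoider.len A))
    ; bounded = All.map⁺ bounded-τ
    ; unique  = Unique.map⁻ (subst Unique (sym (∷-injectiveʳ σ≡)) u)
    ; no4123  = no4123 ∘ Has4123-insert⁺ v τ ∘ inj₂
    ; no1342  = no1342 ∘ Has1342-insert⁺ v τ ∘ inj₂
    }
  found : (∃[ nd ] nd ∈ generation n × τ ≡ word nd) → v ∷ ρ ∈ map word (generation (suc n))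
  found (nd , nd∈ , refl)
    with valid-site nd (All.lookup (generation-valid n) nd∈) v≤n no4123 no1342
  ... | b≤v , v≤e = concatMap-childNodes⁺ (generation n) nd∈
    (subst (v ∷ ρ ∈_) (sym (childNodes-words nd)) (subst (_∈ inserts τ (offset nd) (suc (size (state nd)))) σ≡
      (∈-map⁺ (λ w → insert w τ) (∈-range⁺ (offset nd) (suc (size (state nd))) b≤v
        (subst (v <_) (sym (+-suc (offset nd) (size (state nd)))) (s≤s v≤e))))))

generation-sound : ∀ n {σ} → σ ∈ map word (generation n) → Avoider n σ
generation-sound n σ∈ with ∈-map⁻ word σ∈
... | nd , nd∈ , refl = valid-avoider nd (All.lookup (generation-valid n) nd∈)

-- Comparison with the enumeration by lists of words

∧-true⁻ : ∀ {x y} → x ∧ y ≡ true → x ≡ true × y ≡ true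
∧-true⁻ {true} {true} _ = refl , refl

∨-true⁻ : ∀ {x y} → x ∨ y ≡ true → x ≡ true ⊎ y ≡ true
∨-true⁻ {true}  _ = inj₁ refl
∨-true⁻ {false} p = inj₂ p

module _ {A : Set} (f : A → Bool) where

  all-true⁻ : ∀ {xs x} → all f xs ≡ true → x ∈ xs → f x ≡ true
  all-true⁻ {_ ∷ _} p (here refl) = proj₁ (∧-true⁻ p)
  all-true⁻ {_ ∷ _} p (there x∈)  = all-true⁻ (proj₂ (∧-true⁻ p)) x∈

  any-true⁻ : ∀ {xs} → any f xs ≡ true → ∃[ x ] x ∈ xs × f x ≡ true
  any-true⁻ {x ∷ xs} p with ∨-true⁻ {f x} p
  ... | inj₁ q = x , here refl , q
  ... | inj₂ q with any-true⁻ {xs} q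
  ...   | y , y∈ , r = y , there y∈ , r

  any-true⁺ : ∀ {xs x} → x ∈ xs → f x ≡ true → any f xs ≡ true
  any-true⁺ {x ∷ xs} (here refl) p = cong (_∨ any f xs) p
  any-true⁺ {x ∷ xs} (there x∈) p = trans (cong (f x ∨_) (any-true⁺ {xs} x∈ p)) (∨-zeroʳ (f x))

∈-subseqs⁻ : ∀ σ {s} → s ∈ subseqs σ → s ⊆ σ
∈-subseqs⁻ []      (here refl) = []
∈-subseqs⁻ (x ∷ σ) s∈ with ∈-++⁻ (subseqs σ) s∈
... | inj₁ p = x ∷ʳ ∈-subseqs⁻ σ p
... | inj₂ p with ∈-map⁻ (x ∷_) p
...   | t , q , refl = refl ∷ ∈-subseqs⁻ σ q

∈-subseqs⁺ : ∀ {σ s} → s ⊆ σ → s ∈ subseqs σ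
∈-subseqs⁺ []                = here refl
∈-subseqs⁺ (y ∷ʳ p)          = ∈-++⁺ˡ (∈-subseqs⁺ p)
∈-subseqs⁺ {x ∷ σ} (refl ∷ p) = ∈-++⁺ʳ (subseqs σ) (∈-map⁺ (x ∷_) (∈-subseqs⁺ p))

contains⁻ : ∀ {σ π} → contains σ π ≡ true → ∃[ s ] s ⊆ σ × orderIso π s ≡ true
contains⁻ {σ} p with any-true⁻ _ p
... | s , s∈ , q = s , ∈-subseqs⁻ σ s∈ , q

contains⁺ : ∀ {σ π s} → s ⊆ σ → orderIso π s ≡ true → contains σ π ≡ true
contains⁺ s⊆ = any-true⁺ _ (∈-subseqs⁺ s⊆)

<ᵇ-true⁺ : ∀ {a b} → a < b → (a <ᵇ b) ≡ true
<ᵇ-true⁺ a<b = Equivalence.to T-≡ (<⇒<ᵇ a<b)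

<ᵇ-true⁻ : ∀ {a b} → (a <ᵇ b) ≡ true → a < b
<ᵇ-true⁻ {a} {b} p = <ᵇ⇒< a b (Equivalence.from T-≡ p)

<ᵇ-false : ∀ {a b} → b ≤ a → (a <ᵇ b) ≡ false
<ᵇ-false {a} {b} b≤a with a <ᵇ b in eq
... | false = refl
... | true  = ⊥-elim (<⇒≱ (<ᵇ-true⁻ eq) b≤a)

agree : ℕ × ℕ → ℕ × ℕ → Bool
agree u v = (proj₁ u <ᵇ proj₁ v) ⇔ᵇ (proj₂ u <ᵇ proj₂ v)

orderIso-agree : ∀ π s {u v} → orderIso π s ≡ true → u ∈ zip π s → v ∈ zip π s → agree u v ≡ true
orderIso-agree π s {u} {v} p u∈ v∈ =
  all-true⁻ (agree u) (all-true⁻ (λ u → all (agree u) (zip π s)) (proj₂ (∧-true⁻ p)) u∈) v∈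

-- It suffices to compare the positions of consecutive pattern values. There the pattern side of
-- `agree` reduces to `true`, which leaves the inequality of the entries.
contains-4123⁻ : ∀ {σ} → contains σ p4123 ≡ true → Has4123 σ
contains-4123⁻ p with contains⁻ {π = p4123} p
... | d ∷ a ∷ b ∷ c ∷ [] , s , q = a , b , c , d , s ,
  <ᵇ-true⁻ (iso (there (here refl)) (there (there (here refl)))) ,
  <ᵇ-true⁻ (iso (there (there (here refl))) (there (there (there (here refl))))) ,
  <ᵇ-true⁻ (iso (there (there (there (here refl)))) (here refl))
  where
  iso : ∀ {u v} → u ∈ _ → v ∈ _ → agree u v ≡ true
  iso = orderIso-agree p4123 (d ∷ a ∷ b ∷ c ∷ []) q

contains-1342⁻ : ∀ {σ} → contains σ p1342 ≡ true → Has1342 σ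
contains-1342⁻ p with contains⁻ {π = p1342} p
... | a ∷ c ∷ d ∷ b ∷ [] , s , q = a , b , c , d , s ,
  <ᵇ-true⁻ (iso (here refl) (there (there (there (here refl))))) ,
  <ᵇ-true⁻ (iso (there (there (there (here refl)))) (there (here refl))) ,
  <ᵇ-true⁻ (iso (there (here refl)) (there (there (here refl))))
  where
  iso : ∀ {u v} → u ∈ _ → v ∈ _ → agree u v ≡ true
  iso = orderIso-agree p1342 (a ∷ c ∷ d ∷ b ∷ []) q

module _ {a b c d : ℕ} (a<b : a < b) (b<c : b < c) (c<d : c < d) where

  orderIso-4123 : orderIso p4123 (d ∷ a ∷ b ∷ c ∷ []) ≡ true
  orderIso-4123
    rewrite <ᵇ-true⁺ a<b | <ᵇ-true⁺ b<c | <ᵇ-true⁺ c<d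
          | <ᵇ-true⁺ (<-trans a<b b<c) | <ᵇ-true⁺ (<-trans b<c c<d) | <ᵇ-true⁺ (<-trans a<b (<-trans b<c c<d))
          | <ᵇ-false (<⇒≤ a<b) | <ᵇ-false (<⇒≤ b<c) | <ᵇ-false (<⇒≤ c<d)
          | <ᵇ-false (<⇒≤ (<-trans a<b b<c)) | <ᵇ-false (<⇒≤ (<-trans b<c c<d))
          | <ᵇ-false (<⇒≤ (<-trans a<b (<-trans b<c c<d)))
          | <ᵇ-false (≤-refl {a}) | <ᵇ-false (≤-refl {b}) | <ᵇ-false (≤-refl {c}) | <ᵇ-false (≤-refl {d}) = refl

  orderIso-1342 : orderIso p1342 (a ∷ c ∷ d ∷ b ∷ []) ≡ true
  orderIso-1342
    rewrite <ᵇ-true⁺ a<b | <ᵇ-true⁺ b<c | <ᵇ-true⁺ c<d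
          | <ᵇ-true⁺ (<-trans a<b b<c) | <ᵇ-true⁺ (<-trans b<c c<d) | <ᵇ-true⁺ (<-trans a<b (<-trans b<c c<d))
          | <ᵇ-false (<⇒≤ a<b) | <ᵇ-false (<⇒≤ b<c) | <ᵇ-false (<⇒≤ c<d)
          | <ᵇ-false (<⇒≤ (<-trans a<b b<c)) | <ᵇ-false (<⇒≤ (<-trans b<c c<d))
          | <ᵇ-false (<⇒≤ (<-trans a<b (<-trans b<c c<d)))
          | <ᵇ-false (≤-refl {a}) | <ᵇ-false (≤-refl {b}) | <ᵇ-false (≤-refl {c}) | <ᵇ-false (≤-refl {d}) = refl

not-true⁻ : ∀ {x} → not x ≡ true → x ≢ true
not-true⁻ {false} _ ()

not-true⁺ : ∀ {x} → x ≢ true → not x ≡ true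
not-true⁺ {false} _ = refl
not-true⁺ {true}  p = ⊥-elim (p refl)

avoidsAll⁻ : ∀ {σ} → avoidsAll (p4123 ∷ p1342 ∷ []) σ ≡ true → ¬ Has4123 σ × ¬ Has1342 σ
avoidsAll⁻ {σ} p =
  (λ (_ , _ , _ , _ , s , a<b , b<c , c<d) →
    not-true⁻ (avoids (here refl)) (contains⁺ {π = p4123} s (orderIso-4123 a<b b<c c<d))) ,
  (λ (_ , _ , _ , _ , s , a<b , b<c , c<d) →
    not-true⁻ (avoids (there (here refl))) (contains⁺ {π = p1342} s (orderIso-1342 a<b b<c c<d)))
  where
  avoids : ∀ {π} → π ∈ p4123 ∷ p1342 ∷ [] → not (contains σ π) ≡ true
  avoids = all-true⁻ (λ π → not (contains σ π)) p

avoidsAll⁺ : ∀ {σ} → ¬ Has4123 σ → ¬ Has1342 σ → avoidsAll (p4123 ∷ p1342 ∷ []) σ ≡ true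
avoidsAll⁺ {σ} p q = cong₂ (λ x y → x ∧ (y ∧ true))
  (not-true⁺ (p ∘ contains-4123⁻ {σ})) (not-true⁺ (q ∘ contains-1342⁻ {σ}))

notElem⁻ : ∀ {x ys} → notElem x ys ≡ true → All (x ≢_) ys
notElem⁻ {x} {[]}     _ = []
notElem⁻ {x} {y ∷ ys} p with ∧-true⁻ p
... | q , r = (λ x≡y → not-true⁻ q (Equivalence.to T-≡ (≡⇒≡ᵇ x y x≡y))) ∷ notElem⁻ r

notElem⁺ : ∀ {x ys} → All (x ≢_) ys → notElem x ys ≡ true
notElem⁺ []                    = refl
notElem⁺ {x} {y ∷ ys} (x≢y ∷ h) = cong₂ _∧_
  (not-true⁺ (λ e → x≢y (≡ᵇ⇒≡ x y (Equivalence.from T-≡ e)))) (notElem⁺ h)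

distinct⁻ : ∀ {xs} → distinct xs ≡ true → Unique xs
distinct⁻ {[]}     _ = []
distinct⁻ {x ∷ xs} p with ∧-true⁻ p
... | q , r = notElem⁻ q ∷ distinct⁻ r

distinct⁺ : ∀ {xs} → Unique xs → distinct xs ≡ true
distinct⁺ []      = refl
distinct⁺ (h ∷ u) = cong₂ _∧_ (notElem⁺ h) (distinct⁺ u)

prefixed : List (List ℕ) → List ℕ → List (List ℕ)
prefixed ws xs = concatMap (λ x → map (x ∷_) ws) xs

∈-prefixed⁻ : ∀ ws xs {σ} → σ ∈ prefixed ws xs → ∃[ x ] ∃[ w ] x ∈ xs × w ∈ ws × σ ≡ x ∷ w
∈-prefixed⁻ ws (x ∷ xs) σ∈ with ∈-++⁻ (map (x ∷_) ws) σ∈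
... | inj₁ p with ∈-map⁻ (x ∷_) p
...   | w , w∈ , e = x , w , here refl , w∈ , e
∈-prefixed⁻ ws (x ∷ xs) σ∈ | inj₂ p with ∈-prefixed⁻ ws xs p
... | y , w , y∈ , r = y , w , there y∈ , r

∈-prefixed⁺ : ∀ ws xs {x w} → x ∈ xs → w ∈ ws → x ∷ w ∈ prefixed ws xs
∈-prefixed⁺ ws (x ∷ xs) (here refl) w∈ = ∈-++⁺ˡ (∈-map⁺ (x ∷_) w∈)
∈-prefixed⁺ ws (x ∷ xs) (there x∈)  w∈ = ∈-++⁺ʳ (map (x ∷_) ws) (∈-prefixed⁺ ws xs x∈ w∈)

prefixed-unique : ∀ {ws xs} → Unique ws → Unique xs → Unique (prefixed ws xs)
prefixed-unique           u []      = []
prefixed-unique {ws} {x ∷ xs} u (h ∷ v) = Unique.++⁺ (Unique.map⁺ ∷-injectiveʳ u) (prefixed-unique u v) disjoint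
  where
  disjoint : Disjoint (map (x ∷_) ws) (prefixed ws xs)
  disjoint (p , q) with ∈-map⁻ (x ∷_) p | ∈-prefixed⁻ ws xs q
  ... | _ , _ , refl | _ , _ , y∈ , _ , e = All.lookup h y∈ (∷-injectiveˡ e)

words-unique : ∀ k {xs} → Unique xs → Unique (words k xs)
words-unique zero    u = [] ∷ []
words-unique (suc k) u = prefixed-unique (words-unique k u) u

∈-words⁻ : ∀ k {xs σ} → σ ∈ words k xs → length σ ≡ k × All (_∈ xs) σ
∈-words⁻ zero    (here refl) = refl , []
∈-words⁻ (suc k) {xs} σ∈ with ∈-prefixed⁻ (words k xs) xs σ∈
... | x , w , x∈ , w∈ , refl with ∈-words⁻ k w∈
...   | e , h = cong suc e , x∈ ∷ h

∈-words⁺ : ∀ {xs σ} → All (_∈ xs) σ → σ ∈ words (length σ) xs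
∈-words⁺           []       = here refl
∈-words⁺ {xs} {x ∷ σ} (x∈ ∷ h) = ∈-prefixed⁺ (words (length σ) xs) xs x∈ (∈-words⁺ h)

avoiders : ℕ → List (List ℕ)
avoiders n = filter (λ σ → avoidsAll (p4123 ∷ p1342 ∷ []) σ Bool.≟ true) (Sn n)

avoiders-unique : ∀ n → Unique (avoiders n)
avoiders-unique n = Unique.filter⁺ _ (Unique.filter⁺ _ (words-unique n (Unique.upTo⁺ n)))

avoiders-sound : ∀ n {σ} → σ ∈ avoiders n → Avoider n σ
avoiders-sound n {σ} σ∈ with ∈-filter⁻ (λ σ → avoidsAll (p4123 ∷ p1342 ∷ []) σ Bool.≟ true) {xs = Sn n} σ∈
... | σ∈Sn , avoids with ∈-filter⁻ (λ w → distinct w Bool.≟ true) {xs = words n (upTo n)} σ∈Sn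
...   | σ∈words , dist with ∈-words⁻ n σ∈words
...     | len , bounded = record
  { len     = len
  ; bounded = All.map ∈-upTo⁻ bounded
  ; unique  = distinct⁻ dist
  ; no4123  = proj₁ (avoidsAll⁻ {σ} avoids)
  ; no1342  = proj₂ (avoidsAll⁻ {σ} avoids)
  }

avoiders-complete : ∀ n {σ} → Avoider n σ → σ ∈ avoiders n
avoiders-complete n {σ} A = ∈-filter⁺ (λ σ → avoidsAll (p4123 ∷ p1342 ∷ []) σ Bool.≟ true)
  (∈-filter⁺ (λ w → distinct w Bool.≟ true)
    (subst (λ k → σ ∈ words k (upTo n)) len (∈-words⁺ (All.map ∈-upTo⁺ bounded)))
    (distinct⁺ unique))
  (avoidsAll⁺ {σ} no4123 no1342)
  where open Avoider A

-- Two lists without duplicates and with the same members are rearrangements of each other, so their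
-- lengths agree.
countAv-descendants : ∀ n → countAv n ≡ descendants n (G 0 0)
countAv-descendants n = begin
  length (avoiders n)                ≡⟨ ↭-length (∼bag⇒↭ (unique∧set⇒bag (avoiders-unique n) (generation-unique n)
                                          (mk⇔ (generation-complete n ∘ avoiders-sound n)
                                               (avoiders-complete n ∘ generation-sound n)))) ⟩
  length (map word (generation n))   ≡⟨ length-map word (generation n) ⟩
  length (generation n)              ≡⟨ length-generation n ⟩
  descendants n (G 0 0)              ∎
  where open ≡-Reasoning

infix 4 _≈_
infix 8 ⊖_

-- The ring of power series

-- Wrapped in a record so that f and g can be inferred from f ≈ g.
record _≈_ (f g : Series) : Set where
  constructor mk≈
  field at : ∀ n → f n ≡ g n
open _≈_ public

tail : Series → Series
tail f n = f (suc n)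

scale : ℤ → Series → Series
scale c f n = c *ℤ f n

const : ℤ → Series
const c = poly (c ∷ [])

X : Series
X = poly (+ 0 ∷ + 1 ∷ [])

⊖_ : Series → Series
(⊖ f) n = - f n

⊛-zero : ∀ f g → (f ⊛ g) 0 ≡ f 0 *ℤ g 0
⊛-zero f g = ℤ.+-identityʳ _

⊛-suc : ∀ f g n → (f ⊛ g) (suc n) ≡ f 0 *ℤ g (suc n) +ℤ (tail f ⊛ g) n
⊛-suc f g n = cong (λ ts → f 0 *ℤ g (suc n) +ℤ sumℤ ts)
  (trans (map-applyUpTo suc (λ i → f i *ℤ g (suc n ∸ i)) (suc n))
    (sym (map-applyUpTo (λ i → i) (λ i → f (suc i) *ℤ g (n ∸ i)) (suc n))))

-- Splits off the last term of the convolution where `⊛-suc` splits off the first; together they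
-- turn commutativity into an induction.
⊛-sucʳ : ∀ f g n → (f ⊛ g) (suc n) ≡ f (suc n) *ℤ g 0 +ℤ (f ⊛ tail g) n
⊛-sucʳ f g zero = begin
  (f ⊛ g) 1                    ≡⟨ ⊛-suc f g 0 ⟩
  f 0 *ℤ g 1 +ℤ (tail f ⊛ g) 0   ≡⟨ cong (_+ℤ_ (f 0 *ℤ g 1)) (⊛-zero (tail f) g) ⟩
  f 0 *ℤ g 1 +ℤ f 1 *ℤ g 0        ≡⟨ ℤ.+-comm (f 0 *ℤ g 1) _ ⟩
  f 1 *ℤ g 0 +ℤ f 0 *ℤ g 1        ≡⟨ cong (_+ℤ_ (f 1 *ℤ g 0)) (⊛-zero f (tail g)) ⟨
  f 1 *ℤ g 0 +ℤ (f ⊛ tail g) 0   ∎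
  where open ≡-Reasoning
⊛-sucʳ f g (suc n) = begin
  (f ⊛ g) (suc (suc n))
    ≡⟨ ⊛-suc f g (suc n) ⟩
  f 0 *ℤ g (suc (suc n)) +ℤ (tail f ⊛ g) (suc n)
    ≡⟨ cong (_+ℤ_ (f 0 *ℤ g (suc (suc n)))) (⊛-sucʳ (tail f) g n) ⟩
  f 0 *ℤ g (suc (suc n)) +ℤ (f (suc (suc n)) *ℤ g 0 +ℤ (tail f ⊛ tail g) n)
    ≡⟨ swap (f 0 *ℤ g (suc (suc n))) (f (suc (suc n)) *ℤ g 0) _ ⟩
  f (suc (suc n)) *ℤ g 0 +ℤ (f 0 *ℤ g (suc (suc n)) +ℤ (tail f ⊛ tail g) n)
    ≡⟨ cong (_+ℤ_ (f (suc (suc n)) *ℤ g 0)) (⊛-suc f (tail g) n) ⟨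
  f (suc (suc n)) *ℤ g 0 +ℤ (f ⊛ tail g) (suc n) ∎
  where
  open ≡-Reasoning
  swap : ∀ x y z → x +ℤ (y +ℤ z) ≡ y +ℤ (x +ℤ z)
  swap = solve-∀

⊛-cong : ∀ {f f′ g g′} → f ≈ f′ → g ≈ g′ → f ⊛ g ≈ f′ ⊛ g′
⊛-cong p q = mk≈ (go p q)
  where
  go : ∀ {f f′ g g′} → f ≈ f′ → g ≈ g′ → ∀ n → (f ⊛ g) n ≡ (f′ ⊛ g′) n
  go {f} {f′} {g} {g′} p q zero =
    trans (⊛-zero f g) (trans (cong₂ _*ℤ_ (at p 0) (at q 0)) (sym (⊛-zero f′ g′)))
  go {f} {f′} {g} {g′} p q (suc n) = trans (⊛-suc f g n) (trans
    (cong₂ _+ℤ_ (cong₂ _*ℤ_ (at p 0) (at q (suc n))) (go (mk≈ (at p ∘ suc)) q n))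
    (sym (⊛-suc f′ g′ n)))

⊛-comm : ∀ f g → f ⊛ g ≈ g ⊛ f
⊛-comm f g = mk≈ (go f g)
  where
  go : ∀ f g n → (f ⊛ g) n ≡ (g ⊛ f) n
  go f g zero = trans (⊛-zero f g) (trans (ℤ.*-comm (f 0) (g 0)) (sym (⊛-zero g f)))
  go f g (suc n) = trans (⊛-suc f g n) (trans
    (cong₂ _+ℤ_ (ℤ.*-comm (f 0) (g (suc n))) (go (tail f) g n))
    (sym (⊛-sucʳ g f n)))

⊛-distribʳ : ∀ h f g → (f ⊕ g) ⊛ h ≈ f ⊛ h ⊕ g ⊛ h
⊛-distribʳ h f g = mk≈ (go f g)
  where
  go : ∀ f g n → ((f ⊕ g) ⊛ h) n ≡ (f ⊛ h ⊕ g ⊛ h) n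
  go f g zero = trans (⊛-zero (f ⊕ g) h) (trans (ℤ.*-distribʳ-+ (h 0) (f 0) (g 0))
    (sym (cong₂ _+ℤ_ (⊛-zero f h) (⊛-zero g h))))
  go f g (suc n) = trans (⊛-suc (f ⊕ g) h n) (trans
    (cong (_+ℤ_ ((f 0 +ℤ g 0) *ℤ h (suc n))) (go (tail f) (tail g) n)) (trans
    (regroup (f 0) (g 0) (h (suc n)) _ _)
    (sym (cong₂ _+ℤ_ (⊛-suc f h n) (⊛-suc g h n)))))
    where
    regroup : ∀ x y z u v → (x +ℤ y) *ℤ z +ℤ (u +ℤ v) ≡ (x *ℤ z +ℤ u) +ℤ (y *ℤ z +ℤ v)
    regroup = solve-∀

scale-⊛ : ∀ c f g → scale c f ⊛ g ≈ scale c (f ⊛ g)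
scale-⊛ c f g = mk≈ (go f)
  where
  go : ∀ f n → (scale c f ⊛ g) n ≡ c *ℤ (f ⊛ g) n
  go f zero = trans (⊛-zero (scale c f) g)
    (trans (ℤ.*-assoc c (f 0) (g 0)) (cong (c *ℤ_) (sym (⊛-zero f g))))
  go f (suc n) = trans (⊛-suc (scale c f) g n) (trans
    (cong (_+ℤ_ (c *ℤ f 0 *ℤ g (suc n))) (go (tail f) n)) (trans
    (factor c (f 0) (g (suc n)) _)
    (cong (c *ℤ_) (sym (⊛-suc f g n)))))
    where
    factor : ∀ c x y u → c *ℤ x *ℤ y +ℤ c *ℤ u ≡ c *ℤ (x *ℤ y +ℤ u)
    factor = solve-∀

⊛-assoc : ∀ f g h → (f ⊛ g) ⊛ h ≈ f ⊛ (g ⊛ h)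
⊛-assoc f g h = mk≈ (go f)
  where
  go : ∀ f n → ((f ⊛ g) ⊛ h) n ≡ (f ⊛ (g ⊛ h)) n
  go f zero = trans (⊛-zero (f ⊛ g) h) (trans (cong (_*ℤ h 0) (⊛-zero f g)) (trans
    (ℤ.*-assoc (f 0) (g 0) (h 0)) (trans (cong (f 0 *ℤ_) (sym (⊛-zero g h)))
    (sym (⊛-zero f (g ⊛ h))))))
  go f (suc n) = begin
    ((f ⊛ g) ⊛ h) (suc n)
      ≡⟨ ⊛-suc (f ⊛ g) h n ⟩
    (f ⊛ g) 0 *ℤ h (suc n) +ℤ (tail (f ⊛ g) ⊛ h) n
      ≡⟨ cong₂ (λ u v → u *ℤ h (suc n) +ℤ v) (⊛-zero f g)
          (trans (at (⊛-cong tail-⊛ (mk≈ {h} λ _ → refl)) n)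
                 (at (⊛-distribʳ h (scale (f 0) (tail g)) (tail f ⊛ g)) n)) ⟩
    f 0 *ℤ g 0 *ℤ h (suc n) +ℤ ((scale (f 0) (tail g) ⊛ h) n +ℤ ((tail f ⊛ g) ⊛ h) n)
      ≡⟨ cong₂ (λ u v → f 0 *ℤ g 0 *ℤ h (suc n) +ℤ (u +ℤ v))
          (at (scale-⊛ (f 0) (tail g) h) n) (go (tail f) n) ⟩
    f 0 *ℤ g 0 *ℤ h (suc n) +ℤ (f 0 *ℤ (tail g ⊛ h) n +ℤ (tail f ⊛ (g ⊛ h)) n)
      ≡⟨ regroup (f 0) (g 0) (h (suc n)) _ _ ⟩
    f 0 *ℤ (g 0 *ℤ h (suc n) +ℤ (tail g ⊛ h) n) +ℤ (tail f ⊛ (g ⊛ h)) n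
      ≡⟨ cong (λ u → f 0 *ℤ u +ℤ (tail f ⊛ (g ⊛ h)) n) (⊛-suc g h n) ⟨
    f 0 *ℤ (g ⊛ h) (suc n) +ℤ (tail f ⊛ (g ⊛ h)) n
      ≡⟨ ⊛-suc f (g ⊛ h) n ⟨
    (f ⊛ (g ⊛ h)) (suc n) ∎
    where
    open ≡-Reasoning
    tail-⊛ : tail (f ⊛ g) ≈ scale (f 0) (tail g) ⊕ tail f ⊛ g
    tail-⊛ = mk≈ (⊛-suc f g)
    regroup : ∀ x y z u v → x *ℤ y *ℤ z +ℤ (x *ℤ u +ℤ v) ≡ x *ℤ (y *ℤ z +ℤ u) +ℤ v
    regroup = solve-∀

[]-⊛ : ∀ g n → (poly [] ⊛ g) n ≡ + 0
[]-⊛ g zero    = trans (⊛-zero (poly []) g) (ℤ.*-zeroˡ (g 0))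
[]-⊛ g (suc n) = trans (⊛-suc (poly []) g n) (trans
  (cong₂ _+ℤ_ (ℤ.*-zeroˡ (g (suc n))) ([]-⊛ g n)) refl)

const-⊛ : ∀ c g → const c ⊛ g ≈ scale c g
const-⊛ c g = mk≈ go
  where
  go : ∀ n → (const c ⊛ g) n ≡ c *ℤ g n
  go zero    = ⊛-zero (const c) g
  go (suc n) = trans (⊛-suc (const c) g n)
    (trans (cong (_+ℤ_ (c *ℤ g (suc n))) ([]-⊛ g n)) (ℤ.+-identityʳ _))

X-⊛-zero : ∀ g → (X ⊛ g) 0 ≡ + 0
X-⊛-zero g = trans (⊛-zero X g) (ℤ.*-zeroˡ (g 0))

X-⊛-suc : ∀ g n → (X ⊛ g) (suc n) ≡ g n
X-⊛-suc g n = begin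
  (X ⊛ g) (suc n)                        ≡⟨ ⊛-suc X g n ⟩
  + 0 *ℤ g (suc n) +ℤ (const (+ 1) ⊛ g) n  ≡⟨ cong₂ _+ℤ_ (ℤ.*-zeroˡ (g (suc n))) (at (const-⊛ (+ 1) g) n) ⟩
  + 0 +ℤ + 1 *ℤ g n                        ≡⟨ ℤ.+-identityˡ _ ⟩
  + 1 *ℤ g n                              ≡⟨ ℤ.*-identityˡ (g n) ⟩
  g n                                    ∎
  where open ≡-Reasoning

seriesRing : CommutativeRing 0ℓ 0ℓ
seriesRing = record
  { Carrier = Series ; _≈_ = _≈_ ; _+_ = _⊕_ ; _*_ = _⊛_ ; -_ = ⊖_ ; 0# = poly [] ; 1# = const (+ 1)
  ; isCommutativeRing = record
    { isRing = record
      { +-isAbelianGroup = record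
        { isGroup = record
          { isMonoid = record
            { isSemigroup = record
              { isMagma = record
                { isEquivalence = record
                  { refl  = mk≈ λ _ → refl
                  ; sym   = λ p → mk≈ λ n → sym (at p n)
                  ; trans = λ p q → mk≈ λ n → trans (at p n) (at q n)
                  }
                ; ∙-cong = λ p q → mk≈ λ n → cong₂ _+ℤ_ (at p n) (at q n)
                }
              ; assoc = λ f g h → mk≈ λ n → ℤ.+-assoc (f n) (g n) (h n)
              }
            ; identity = (λ f → mk≈ λ n → ℤ.+-identityˡ (f n)) , (λ f → mk≈ λ n → ℤ.+-identityʳ (f n))
            }
          ; inverse = (λ f → mk≈ λ n → ℤ.+-inverseˡ (f n)) , (λ f → mk≈ λ n → ℤ.+-inverseʳ (f n))
          ; ⁻¹-cong = λ p → mk≈ λ n → cong -_ (at p n)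
          }
        ; comm = λ f g → mk≈ λ n → ℤ.+-comm (f n) (g n)
        }
      ; *-cong     = ⊛-cong
      ; *-assoc    = ⊛-assoc
      ; *-identity = identityˡ , λ f → ≈-trans (⊛-comm f _) (identityˡ f)
      ; distrib    = distribˡ , ⊛-distribʳ
      }
    ; *-comm = ⊛-comm
    }
  }
  where
  ≈-trans : ∀ {f g h} → f ≈ g → g ≈ h → f ≈ h
  ≈-trans p q = mk≈ λ n → trans (at p n) (at q n)
  identityˡ : ∀ f → const (+ 1) ⊛ f ≈ f
  identityˡ f = ≈-trans (const-⊛ (+ 1) f) (mk≈ λ n → ℤ.*-identityˡ (f n))
  distribˡ : ∀ h f g → h ⊛ (f ⊕ g) ≈ h ⊛ f ⊕ h ⊛ g
  distribˡ h f g = ≈-trans (⊛-comm h (f ⊕ g)) (≈-trans (⊛-distribʳ h f g)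
    (mk≈ λ n → cong₂ _+ℤ_ (at (⊛-comm f h) n) (at (⊛-comm g h) n)))

module R = CommutativeRing seriesRing

ℤ-rawRing : RawRing 0ℓ 0ℓ
ℤ-rawRing = CommutativeRing.rawRing ℤ.+-*-commutativeRing

const-morphism : ℤ-rawRing -Raw-AlmostCommutative⟶ fromCommutativeRing seriesRing
const-morphism = record
  { ⟦_⟧    = const
  ; +-homo = λ c d → mk≈ λ { zero → refl ; (suc n) → refl }
  ; *-homo = λ c d → R.sym (R.trans (const-⊛ c (const d))
                       (mk≈ λ { zero → refl ; (suc n) → ℤ.*-zeroʳ c }))
  ; -‿homo = λ c → mk≈ λ { zero → refl ; (suc n) → refl }
  ; 0-homo = mk≈ λ { zero → refl ; (suc n) → refl }
  ; 1-homo = R.refl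
  }

const-≟ : ∀ c d → Maybe (const c ≈ const d)
const-≟ c d with c ℤ.≟ d
... | yes refl = just R.refl
... | no _     = nothing

module Solver = Algebra.Solver.Ring ℤ-rawRing (fromCommutativeRing seriesRing) const-morphism const-≟

poly-∷ : ∀ c cs → poly (c ∷ cs) ≈ const c ⊕ X ⊛ poly cs
poly-∷ c cs = mk≈ λ
  { zero    → sym (trans (cong (_+ℤ_ c) (X-⊛-zero (poly cs))) (ℤ.+-identityʳ c))
  ; (suc n) → sym (trans (ℤ.+-identityˡ _) (X-⊛-suc (poly cs) n)) }

-- Solving the system of generating functions

⊕-cong : ∀ {f f′ g g′} → f ≈ f′ → g ≈ g′ → f ⊕ g ≈ f′ ⊕ g′
⊕-cong p q = mk≈ λ n → cong₂ _+ℤ_ (at p n) (at q n)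

⊕-congˡ : ∀ f {g g′} → g ≈ g′ → f ⊕ g ≈ f ⊕ g′
⊕-congˡ f = ⊕-cong {f} {f} R.refl

⊛-congˡ : ∀ f {g g′} → g ≈ g′ → f ⊛ g ≈ f ⊛ g′
⊛-congˡ f = ⊛-cong {f} {f} R.refl

⊛-leading : ∀ u f n → (∀ {i} → i < n → f i ≡ + 0) → (u ⊛ f) n ≡ u 0 *ℤ f n
⊛-leading u f zero    z = ⊛-zero u f
⊛-leading u f (suc n) z = trans (⊛-suc u f n) (trans
  (cong (_+ℤ_ (u 0 *ℤ f (suc n))) (trans
    (⊛-leading (tail u) f n (λ i<n → z (m<n⇒m<1+n i<n)))
    (trans (cong (u 1 *ℤ_) (z ≤-refl)) (ℤ.*-zeroʳ (u 1)))))
  (ℤ.+-identityʳ _))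

-- Strong induction on the index of the coefficient, for the whole family at once. If all lower
-- coefficients vanish, the coefficient of the product is `u 0` times that of `F l`, and the
-- integers have no zero divisors.
vanish : ∀ u → ¬ u 0 ≡ + 0 → (F : ℕ → Series) →
  (∀ l n → (∀ l {i} → i < n → F l i ≡ + 0) → (u ⊛ F l) n ≡ + 0) → ∀ l → F l ≈ poly []
vanish u u₀≢0 F step l = mk≈ λ n → <-rec (λ n → ∀ l → F l n ≡ + 0) coefficient n l
  where
  coefficient : ∀ n → (∀ {i} → i < n → ∀ l → F l i ≡ + 0) → ∀ l → F l n ≡ + 0
  coefficient n below l with ℤ.i*j≡0⇒i≡0∨j≡0 (u 0)
    (trans (sym (⊛-leading u (F l) n (λ i<n → below i<n l))) (step l n (λ l i<n → below i<n l)))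
  ... | inj₁ u₀≡0 = ⊥-elim (u₀≢0 u₀≡0)
  ... | inj₂ z    = z

⊛-cancel-zero : ∀ u f → ¬ u 0 ≡ + 0 → u ⊛ f ≈ poly [] → f ≈ poly []
⊛-cancel-zero u f u₀≢0 p = vanish u u₀≢0 (λ _ → f) (λ _ n _ → at p n) 0

-- F l is divisible by every power of X.
shift-vanish : ∀ u v → ¬ u 0 ≡ + 0 → (F : ℕ → Series) →
  (∀ l → u ⊛ F l ≈ X ⊛ (v ⊛ F (suc l))) → ∀ l → F l ≈ poly []
shift-vanish u v u₀≢0 F p = vanish u u₀≢0 F step
  where
  step : ∀ l n → (∀ l {i} → i < n → F l i ≡ + 0) → (u ⊛ F l) n ≡ + 0
  step l zero    _     = trans (at (p l) 0) (X-⊛-zero (v ⊛ F (suc l)))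
  step l (suc n) below = begin
    (u ⊛ F l) (suc n)                  ≡⟨ at (p l) (suc n) ⟩
    (X ⊛ (v ⊛ F (suc l))) (suc n)      ≡⟨ X-⊛-suc (v ⊛ F (suc l)) n ⟩
    (v ⊛ F (suc l)) n                  ≡⟨ ⊛-leading v (F (suc l)) n (λ i<n → below (suc l) (m<n⇒m<1+n i<n)) ⟩
    v 0 *ℤ F (suc l) n                  ≡⟨ cong (v 0 *ℤ_) (below (suc l) ≤-refl) ⟩
    v 0 *ℤ + 0                          ≡⟨ ℤ.*-zeroʳ (v 0) ⟩
    + 0                                ∎
    where open ≡-Reasoning

-- Equations as linear combinations of known equations

open Solver using (solve; _:=_; _:+_; _:*_; _:-_; :-_; con; Polynomial)

infixl 6 _⊝_
_⊝_ : Series → Series → Series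
f ⊝ g = f ⊕ ⊖ g

shift-zero : (F : ℕ → Series) → (∀ l → F l ≈ X ⊛ F (suc l)) → ∀ l → F l ≈ poly []
shift-zero F p = shift-vanish (const (+ 1)) (const (+ 1)) (λ ()) F
  (λ l → R.trans (R.*-identityˡ (F l)) (R.trans (p l) (⊛-congˡ X (R.sym (R.*-identityˡ (F (suc l)))))))

⊝-zero : ∀ {f g} → f ≈ g → f ⊝ g ≈ poly []
⊝-zero {f} {g} p = R.trans (R.+-cong p R.refl) (R.-‿inverseʳ g)

zero-⊝ : ∀ {f g} → f ⊝ g ≈ poly [] → f ≈ g
zero-⊝ {f} {g} p = R.trans (solve 2 (λ f g → f := (f :- g) :+ g) R.refl f g)
  (R.trans (R.+-cong p R.refl) (R.+-identityˡ g))

infix 6 _·_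
record Multiple : Set where
  constructor _·_
  field
    {left right} : Series
    factor       : Series
    equation     : left ≈ right

-- The empty sum is `const (+ 0)` because this is what the solver's `:0` evaluates to; `poly []` is
-- only pointwise equal to it.
combination : List Multiple → Series
combination []                            = const (+ 0)
combination (_·_ {left} {right} c e ∷ ms) = c ⊛ (left ⊝ right) ⊕ combination ms

combination-zero : ∀ ms → combination ms ≈ poly []
combination-zero []           = mk≈ λ { zero → refl ; (suc n) → refl }
combination-zero (c · e ∷ ms) = R.trans
  (R.+-cong (R.trans (⊛-congˡ c (⊝-zero e)) (R.zeroʳ c)) (combination-zero ms))
  (R.+-identityˡ _)

-- p ≈ q because p − q is a combination of the differences of known equations.
combine : ∀ {p q} ms → p ⊝ q ≈ combination ms → p ≈ q
combine ms e = zero-⊝ (R.trans e (combination-zero ms))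

-- Generating functions of the states

gf : State → Series
gf s n = + descendants n s

Σgf : List State → Series
Σgf []       = const (+ 0)
Σgf (s ∷ ss) = gf s ⊕ Σgf ss

Σgf-coefficient : ∀ ss n → Σgf ss n ≡ + sum (map (descendants n) ss)
Σgf-coefficient []       zero    = refl
Σgf-coefficient []       (suc n) = refl
Σgf-coefficient (s ∷ ss) n       = cong (_+ℤ_ (gf s n)) (Σgf-coefficient ss n)

Σgf-++ : ∀ ss ts → Σgf (ss ++ ts) ≈ Σgf ss ⊕ Σgf ts
Σgf-++ []       ts = solve 1 (λ t → t := con (+ 0) :+ t) R.refl (Σgf ts)
Σgf-++ (s ∷ ss) ts = R.trans (⊕-congˡ (gf s) (Σgf-++ ss ts)) (R.sym (R.+-assoc (gf s) (Σgf ss) (Σgf ts)))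

gf-children : ∀ s → gf s ≈ const (+ 1) ⊕ X ⊛ Σgf (children s)
gf-children s = mk≈ λ
  { zero    → sym (cong (_+ℤ_ (+ 1)) (X-⊛-zero (Σgf (children s))))
  ; (suc n) → sym (trans (ℤ.+-identityˡ _) (trans (X-⊛-suc (Σgf (children s)) n) (Σgf-coefficient (children s) n))) }

𝟏 −𝟏 1−X 1−2X : Series
𝟏    = const (+ 1)
−𝟏   = const -1ℤ
1−X  = 𝟏 ⊝ X
1−2X = 𝟏 ⊝ const (+ 2) ⊛ X

ΣG ΣH ΣG′ : ℕ → Series
ΣG n  = Σgf (applyDownFrom (G 1) n)
ΣH n  = Σgf (applyDownFrom (H 1) n)
ΣG′ n = Σgf (applyDownFrom (λ d → G 1 (suc d)) n)

G-equation : ∀ l m → gf (G l m) ≈ const (+ 1) ⊕ X ⊛ (ΣH l ⊕ (gf (G (suc l) m) ⊕ ΣG m))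
G-equation l m = R.trans (gf-children (G l m))
  (⊕-congˡ 𝟏 (⊛-congˡ X (Σgf-++ (applyDownFrom (H 1) l) (G (suc l) m ∷ applyDownFrom (G 1) m))))

H-equation : ∀ l m → gf (H l m) ≈
  const (+ 1) ⊕ X ⊛ (ΣH l ⊕ (gf (H (suc l) m) ⊕ (ΣH m ⊕ (gf (K l (suc m)) ⊕ const (+ 0)))))
H-equation l m = R.trans (gf-children (H l m))
  (⊕-congˡ 𝟏 (⊛-congˡ X (R.trans
    (Σgf-++ (applyDownFrom (H 1) l) (H (suc l) m ∷ applyDownFrom (H 1) m ++ K l (suc m) ∷ []))
    (⊕-congˡ (ΣH l) (⊕-congˡ (gf (H (suc l) m)) (Σgf-++ (applyDownFrom (H 1) m) (K l (suc m) ∷ [])))))))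

K-equation : ∀ l s → gf (K l s) ≈
  const (+ 1) ⊕ X ⊛ (ΣG′ l ⊕ (ΣH (suc s) ⊕ (gf (K l (suc s)) ⊕ const (+ 0))))
K-equation l s = R.trans (gf-children (K l s))
  (⊕-congˡ 𝟏 (⊛-congˡ X (R.trans
    (Σgf-++ (applyDownFrom (λ d → G 1 (suc d)) l) (applyDownFrom (H 1) (suc s) ++ K l (suc s) ∷ []))
    (⊕-congˡ (ΣG′ l) (Σgf-++ (applyDownFrom (H 1) (suc s)) (K l (suc s) ∷ []))))))

:0 :1 :−1 : ∀ {n} → Polynomial n
:0  = con (+ 0)
:1  = con (+ 1)
:−1 = con -1ℤ

-- Differences in the second parameter

a c : ℕ → Series
a n = gf (H 1 n)
c n = gf (G 1 n)

Δ η γ : ℕ → ℕ → Series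
Δ l s = gf (K l (suc s)) ⊝ gf (K l s)
η l m = gf (H l (suc m)) ⊝ gf (H l m)
γ l m = gf (G l (suc m)) ⊝ gf (G l m)

Δ-step : ∀ l s → Δ l s ≈ X ⊛ (a (suc s) ⊕ Δ l (suc s))
Δ-step l s = combine (𝟏 · K-equation l (suc s) ∷ −𝟏 · K-equation l s ∷ [])
  (solve 7 (λ x k₀ k₁ k₂ u h a →
    (k₁ :- k₀) :- x :* (a :+ (k₂ :- k₁)) :=
    :1 :* (k₁ :- (:1 :+ x :* (u :+ ((a :+ h) :+ (k₂ :+ :0))))) :+
    (:−1 :* (k₀ :- (:1 :+ x :* (u :+ (h :+ (k₁ :+ :0))))) :+ :0))
    R.refl X (gf (K l s)) (gf (K l (suc s))) (gf (K l (suc (suc s)))) (ΣG′ l) (ΣH (suc s)) (a (suc s)))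

-- In `Δ-step` the sum over l has cancelled and l occurs only in `Δ` itself. The difference of two
-- solutions therefore satisfies the homogeneous recursion in s.
Δ-constant : ∀ l s → Δ l s ≈ Δ 0 s
Δ-constant l s = zero-⊝ (shift-zero (λ s → Δ l s ⊝ Δ 0 s) step s)
  where
  step : ∀ s → Δ l s ⊝ Δ 0 s ≈ X ⊛ (Δ l (suc s) ⊝ Δ 0 (suc s))
  step s = combine (𝟏 · Δ-step l s ∷ −𝟏 · Δ-step 0 s ∷ [])
    (solve 6 (λ x a d e d′ e′ →
      (d :- e) :- x :* (d′ :- e′) :=
      :1 :* (d :- x :* (a :+ d′)) :+ (:−1 :* (e :- x :* (a :+ e′)) :+ :0))
      R.refl X (a (suc s)) (Δ l s) (Δ 0 s) (Δ l (suc s)) (Δ 0 (suc s)))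

η-step : ∀ l m → η l m ≈ X ⊛ (η (suc l) m ⊕ (a m ⊕ Δ l (suc m)))
η-step l m = combine (𝟏 · H-equation l (suc m) ∷ −𝟏 · H-equation l m ∷ [])
  (solve 10 (λ x h₀ h₁ h₀′ h₁′ k₁ k₂ u h a →
    (h₁ :- h₀) :- x :* ((h₁′ :- h₀′) :+ (a :+ (k₂ :- k₁))) :=
    :1 :* (h₁ :- (:1 :+ x :* (u :+ (h₁′ :+ ((a :+ h) :+ (k₂ :+ :0)))))) :+
    (:−1 :* (h₀ :- (:1 :+ x :* (u :+ (h₀′ :+ (h :+ (k₁ :+ :0)))))) :+ :0))
    R.refl X (gf (H l m)) (gf (H l (suc m))) (gf (H (suc l) m)) (gf (H (suc l) (suc m)))
    (gf (K l (suc m))) (gf (K l (suc (suc m)))) (ΣH l) (ΣH m) (a m))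

-- Since `Δ` does not depend on l, neither does the inhomogeneous term of `η-step`. The constant
-- solution is X (a m + Δ 0 (m+1)) / (1 - X), here with the denominator cleared.
η-equation : ∀ l m → 1−X ⊛ η l m ≈ X ⊛ (a m ⊕ Δ 0 (suc m))
η-equation l m = zero-⊝ (shift-zero (λ l → 1−X ⊛ η l m ⊝ X ⊛ (a m ⊕ Δ 0 (suc m))) step l)
  where
  step : ∀ l → 1−X ⊛ η l m ⊝ X ⊛ (a m ⊕ Δ 0 (suc m)) ≈ X ⊛ (1−X ⊛ η (suc l) m ⊝ X ⊛ (a m ⊕ Δ 0 (suc m)))
  step l = combine (1−X · η-step l m ∷ X ⊛ 1−X · Δ-constant l (suc m) ∷ [])
    (solve 6 (λ x a e e′ d d₀ →
      ((:1 :- x) :* e :- x :* (a :+ d₀)) :- x :* ((:1 :- x) :* e′ :- x :* (a :+ d₀)) :=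
      (:1 :- x) :* (e :- x :* (e′ :+ (a :+ d))) :+ (x :* (:1 :- x) :* (d :- d₀) :+ :0))
      R.refl X (a m) (η l m) (η (suc l) m) (Δ l (suc m)) (Δ 0 (suc m)))

-- The left side is `η 1 m`. Moving X η to the right in `η-equation` turns a m into a (m+1), which
-- gives the right side of `Δ-step`.
a-difference : ∀ m → a (suc m) ⊝ a m ≈ Δ 0 m
a-difference m = combine (𝟏 · η-equation 1 m ∷ −𝟏 · Δ-step 0 m ∷ [])
  (solve 5 (λ x a₀ a₁ d d′ →
    (a₁ :- a₀) :- d :=
    :1 :* ((:1 :- x) :* (a₁ :- a₀) :- x :* (a₀ :+ d′)) :+ (:−1 :* (d :- x :* (a₁ :+ d′)) :+ :0))
    R.refl X (a m) (a (suc m)) (Δ 0 m) (Δ 0 (suc m)))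

-- Both occurrences of `Δ` in `Δ-step` are replaced by differences of the series `a`, and a (m+1)
-- cancels inside the bracket.
a-recurrence : ∀ m → a (suc m) ≈ a m ⊕ X ⊛ a (suc (suc m))
a-recurrence m = combine (𝟏 · a-difference m ∷ 𝟏 · Δ-step 0 m ∷ ⊖ X · a-difference (suc m) ∷ [])
  (solve 6 (λ x a₀ a₁ a₂ d d′ →
    a₁ :- (a₀ :+ x :* a₂) :=
    :1 :* ((a₁ :- a₀) :- d) :+ (:1 :* (d :- x :* (a₁ :+ d′)) :+ (:- x :* ((a₂ :- a₁) :- d′) :+ :0)))
    R.refl X (a m) (a (suc m)) (a (suc (suc m))) (Δ 0 m) (Δ 0 (suc m)))

Δ-closed : ∀ l s → Δ l s ≈ X ⊛ a (suc (suc s))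
Δ-closed l s = combine (𝟏 · Δ-constant l s ∷ −𝟏 · a-difference s ∷ 𝟏 · a-recurrence s ∷ [])
  (solve 6 (λ x a₀ a₁ a₂ d d₀ →
    d :- x :* a₂ :=
    :1 :* (d :- d₀) :+ (:−1 :* ((a₁ :- a₀) :- d₀) :+ (:1 :* (a₁ :- (a₀ :+ x :* a₂)) :+ :0)))
    R.refl X (a s) (a (suc s)) (a (suc (suc s))) (Δ l s) (Δ 0 s))

γ-step : ∀ l m → γ l m ≈ X ⊛ (γ (suc l) m ⊕ c m)
γ-step l m = combine (𝟏 · G-equation l (suc m) ∷ −𝟏 · G-equation l m ∷ [])
  (solve 8 (λ x g₀ g₁ g₀′ g₁′ u t c →
    (g₁ :- g₀) :- x :* ((g₁′ :- g₀′) :+ c) :=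
    :1 :* (g₁ :- (:1 :+ x :* (u :+ (g₁′ :+ (c :+ t))))) :+
    (:−1 :* (g₀ :- (:1 :+ x :* (u :+ (g₀′ :+ t)))) :+ :0))
    R.refl X (gf (G l m)) (gf (G l (suc m))) (gf (G (suc l) m)) (gf (G (suc l) (suc m))) (ΣH l) (ΣG m) (c m))

γ-equation : ∀ l m → 1−X ⊛ γ l m ≈ X ⊛ c m
γ-equation l m = zero-⊝ (shift-zero (λ l → 1−X ⊛ γ l m ⊝ X ⊛ c m) step l)
  where
  step : ∀ l → 1−X ⊛ γ l m ⊝ X ⊛ c m ≈ X ⊛ (1−X ⊛ γ (suc l) m ⊝ X ⊛ c m)
  step l = combine (1−X · γ-step l m ∷ [])
    (solve 4 (λ x c g g′ →
      ((:1 :- x) :* g :- x :* c) :- x :* ((:1 :- x) :* g′ :- x :* c) :=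
      (:1 :- x) :* (g :- x :* (g′ :+ c)) :+ :0)
      R.refl X (c m) (γ l m) (γ (suc l) m))

c-recurrence : ∀ m → 1−X ⊛ c (suc m) ≈ c m
c-recurrence m = combine (𝟏 · γ-equation 1 m ∷ [])
  (solve 3 (λ x c₀ c₁ →
    (:1 :- x) :* c₁ :- c₀ := :1 :* ((:1 :- x) :* (c₁ :- c₀) :- x :* c₀) :+ :0)
    R.refl X (c m) (c (suc m)))

-- The parts of the equations below that do not depend on the running index.
κ κ₂ ν : Series
κ  = X ⊛ a 0 ⊕ X ⊛ a 1 ⊝ a 0
κ₂ = 𝟏 ⊝ c 0 ⊕ X ⊛ a 0 ⊝ a 0 ⊕ a 1
ν  = 1−X ⊛ (𝟏 ⊕ κ) ⊕ X ⊛ κ₂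

-- A telescoping sum: from n to n + 1 the right side grows by a (n+1) - a n - X a (n+2) + X a (n+1),
-- of which `a-recurrence` leaves X a (n+1). The case n = 0 fixes `κ`.
X⊛ΣH : ∀ n → X ⊛ ΣH (suc n) ≈ a n ⊝ X ⊛ a (suc n) ⊕ κ
X⊛ΣH zero = solve 3 (λ x a₀ a₁ →
  x :* (a₀ :+ :0) := a₀ :- x :* a₁ :+ (x :* a₀ :+ x :* a₁ :- a₀)) R.refl X (a 0) (a 1)
X⊛ΣH (suc n) = combine (𝟏 · X⊛ΣH n ∷ −𝟏 · a-recurrence n ∷ [])
  (solve 6 (λ x a₀ a₁ a₂ h k →
    x :* (a₁ :+ h) :- (a₁ :- x :* a₂ :+ k) :=
    :1 :* (x :* h :- (a₀ :- x :* a₁ :+ k)) :+ (:−1 :* (a₁ :- (a₀ :+ x :* a₂)) :+ :0))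
    R.refl X (a n) (a (suc n)) (a (suc (suc n))) (ΣH (suc n)) κ)

X⊛ΣG′ : ∀ l → X ⊛ ΣG′ l ≈ c l ⊝ c 0
X⊛ΣG′ zero = solve 2 (λ x c₀ → x :* :0 := c₀ :- c₀) R.refl X (c 0)
X⊛ΣG′ (suc l) = combine (𝟏 · X⊛ΣG′ l ∷ −𝟏 · c-recurrence l ∷ [])
  (solve 5 (λ x c₀ cₗ c₁ u →
    x :* (c₁ :+ u) :- (c₁ :- c₀) :=
    :1 :* (x :* u :- (cₗ :- c₀)) :+ (:−1 :* ((:1 :- x) :* c₁ :- cₗ) :+ :0))
    R.refl X (c 0) (c l) (c (suc l)) (ΣG′ l))

-- By `X⊛ΣH`, the difference D n of the two series satisfies D n = 1 + κ + X D (n+1), whose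
-- inhomogeneous term is free of n.
G-closed : ∀ n → 1−X ⊛ (gf (G (suc n) 0) ⊝ a n) ≈ 𝟏 ⊕ κ
G-closed n = zero-⊝ (shift-zero F step n)
  where
  F : ℕ → Series
  F n = 1−X ⊛ (gf (G (suc n) 0) ⊝ a n) ⊝ (𝟏 ⊕ κ)
  step : ∀ n → F n ≈ X ⊛ F (suc n)
  step n = combine (1−X · G-equation (suc n) 0 ∷ 1−X · X⊛ΣH n ∷ [])
    (solve 7 (λ x g g′ a₀ a₁ k h →
      ((:1 :- x) :* (g :- a₀) :- (:1 :+ k)) :- x :* ((:1 :- x) :* (g′ :- a₁) :- (:1 :+ k)) :=
      (:1 :- x) :* (g :- (:1 :+ x :* (h :+ (g′ :+ :0)))) :+
      ((:1 :- x) :* (x :* h :- (a₀ :- x :* a₁ :+ k)) :+ :0))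
      R.refl X (gf (G (suc n) 0)) (gf (G (suc (suc n)) 0)) (a n) (a (suc n)) κ (ΣH (suc n)))

c₀-equation : 1−X ⊛ c 0 ≈ 𝟏 ⊕ X ⊛ a 1
c₀-equation = combine (𝟏 · G-closed 0 ∷ [])
  (solve 4 (λ x c₀ a₀ a₁ →
    (:1 :- x) :* c₀ :- (:1 :+ x :* a₁) :=
    :1 :* ((:1 :- x) :* (c₀ :- a₀) :- (:1 :+ (x :* a₀ :+ x :* a₁ :- a₀))) :+ :0)
    R.refl X (c 0) (a 0) (a 1))

-- `Δ-closed` writes the series of `K l 2` as that of `K l 1` plus X a 3, so the equation closes up.
-- `a-recurrence` then lowers X² a 3 and X a 2 to `a 0` and `a 1`.
K-closed : ∀ l → 1−X ⊛ gf (K l 1) ≈ c l ⊕ κ₂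
K-closed l = combine
  (𝟏 · K-equation l 1 ∷ X · Δ-closed l 1 ∷ 𝟏 · X⊛ΣG′ l ∷ −𝟏 · a-recurrence 0 ∷ ⊖ X · a-recurrence 1 ∷ [])
  (solve 10 (λ x k₁ k₂ u a₀ a₁ a₂ a₃ c₀ cₗ →
    (:1 :- x) :* k₁ :- (cₗ :+ (:1 :- c₀ :+ x :* a₀ :- a₀ :+ a₁)) :=
    :1 :* (k₁ :- (:1 :+ x :* (u :+ ((a₁ :+ (a₀ :+ :0)) :+ (k₂ :+ :0))))) :+
    (x :* ((k₂ :- k₁) :- x :* a₃) :+
    (:1 :* (x :* u :- (cₗ :- c₀)) :+
    (:−1 :* (a₁ :- (a₀ :+ x :* a₂)) :+
    (:- x :* (a₂ :- (a₁ :+ x :* a₃)) :+ :0)))))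
    R.refl X (gf (K l 1)) (gf (K l 2)) (ΣG′ l) (a 0) (a 1) (a 2) (a 3) (c 0) (c l))

-- After subtracting a n, the inhomogeneous term contains X c (n+1) / (1 - X), where `c` is
-- geometric with ratio 1/(1 - X). The particular solution for this part is X c n / ((1 - X)(1 -
-- 2X)), and the constant part contributes ν / (1 - X)².
H-closed : ∀ n → 1−2X ⊛ (1−X ⊛ 1−X) ⊛ (gf (H (suc n) 0) ⊝ a n) ≈ X ⊛ 1−X ⊛ c n ⊕ 1−2X ⊛ ν
H-closed n = zero-⊝ (shift-zero F step n)
  where
  F : ℕ → Series
  F n = 1−2X ⊛ (1−X ⊛ 1−X) ⊛ (gf (H (suc n) 0) ⊝ a n) ⊝ (X ⊛ 1−X ⊛ c n ⊕ 1−2X ⊛ ν)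
  step : ∀ n → F n ≈ X ⊛ F (suc n)
  step n = combine
    (1−2X ⊛ (1−X ⊛ 1−X) · H-equation (suc n) 0 ∷ 1−2X ⊛ (1−X ⊛ 1−X) · X⊛ΣH n ∷
     1−2X ⊛ 1−X ⊛ X · K-closed (suc n) ∷ 1−X ⊛ X · c-recurrence n ∷ [])
    (solve 11 (λ x h h′ a₀ a₁ c₀ c₁ k k₂ k′ u →
      let y = :1 :- x; z = :1 :- con (+ 2) :* x; ν = y :* (:1 :+ k) :+ x :* k₂ in
      (z :* (y :* y) :* (h :- a₀) :- (x :* y :* c₀ :+ z :* ν)) :-
        x :* (z :* (y :* y) :* (h′ :- a₁) :- (x :* y :* c₁ :+ z :* ν)) :=
      z :* (y :* y) :* (h :- (:1 :+ x :* (u :+ (h′ :+ (:0 :+ (k′ :+ :0)))))) :+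
      (z :* (y :* y) :* (x :* u :- (a₀ :- x :* a₁ :+ k)) :+
      (z :* y :* x :* (y :* k′ :- (c₁ :+ k₂)) :+
      (y :* x :* (y :* c₁ :- c₀) :+ :0))))
      R.refl X (gf (H (suc n) 0)) (gf (H (suc (suc n)) 0)) (a n) (a (suc n)) (c n) (c (suc n))
      κ κ₂ (gf (K (suc n) 1)) (ΣH (suc n)))

-- Written with ring operations only, so that the solver can see inside; `:horner` is the same
-- expression as solver syntax.
horner : List ℤ → Series
horner []       = const (+ 0)
horner (c ∷ cs) = const c ⊕ X ⊛ horner cs

poly-horner : ∀ cs → poly cs ≈ horner cs
poly-horner []       = mk≈ λ { zero → refl ; (suc n) → refl }
poly-horner (c ∷ cs) = R.trans (poly-∷ c cs) (⊕-congˡ (const c) (⊛-congˡ X (poly-horner cs)))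

:horner : ∀ {n} → Polynomial n → List ℤ → Polynomial n
:horner x []       = con (+ 0)
:horner x (c ∷ cs) = con c :+ x :* :horner x cs

-- mCoeffs is polBCoeffs + (1 − 2X)(1 − X)² and qCoeffs is (1 − 2X)(1 − X)² − polBCoeffs.
denCoeffs facCoeffs polACoeffs polBCoeffs mCoeffs qCoeffs 1−4XCoeffs : List ℤ
denCoeffs  = + 2 ∷ neg 22 ∷ + 96 ∷ neg 220 ∷ + 282 ∷ neg 196 ∷ + 64 ∷ neg 8 ∷ []
facCoeffs  = + 0 ∷ + 1 ∷ neg 3 ∷ + 2 ∷ []
polACoeffs = + 1 ∷ neg 7 ∷ + 17 ∷ neg 16 ∷ + 4 ∷ []
polBCoeffs = + 1 ∷ neg 3 ∷ + 3 ∷ []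
mCoeffs    = + 2 ∷ neg 7 ∷ + 8 ∷ neg 2 ∷ []
qCoeffs    = + 0 ∷ neg 1 ∷ + 2 ∷ neg 2 ∷ []
1−4XCoeffs = + 1 ∷ neg 4 ∷ []

hDen hFac hA hB hM : Series
hDen = horner denCoeffs
hFac = horner facCoeffs
hA   = horner polACoeffs
hB   = horner polBCoeffs
hM   = horner mCoeffs

-- At n = 0 the left side of `H-closed` is zero, as `a 0` is the series of `H 1 0`. On the right
-- `c 0` has coefficient X², so after multiplication by 1 - X it is eliminated by `c₀-equation`.
a₀-equation : hB ⊕ X ⊛ a 1 ⊛ hM ≈ 1−2X ⊛ (1−X ⊛ 1−X) ⊛ a 0
a₀-equation = combine (−𝟏 ⊛ 1−X · H-closed 0 ∷ ⊖ (X ⊛ X) · c₀-equation ∷ [])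
  (solve 4 (λ x a₀ a₁ c₀ →
    let y = :1 :- x; z = :1 :- con (+ 2) :* x
        k = x :* a₀ :+ x :* a₁ :- a₀; k₂ = :1 :- c₀ :+ x :* a₀ :- a₀ :+ a₁ in
    :horner x polBCoeffs :+ x :* a₁ :* :horner x mCoeffs
      :- z :* (y :* y) :* a₀ :=
    :−1 :* y :* (z :* (y :* y) :* (a₀ :- a₀) :- (x :* y :* c₀ :+ z :* (y :* (:1 :+ k) :+ x :* k₂))) :+
    (:- (x :* x) :* (y :* c₀ :- (:1 :+ x :* a₁)) :+ :0))
    R.refl X (a 0) (a 1) (c 0))

-- Closed form in terms of the square root

module _ (s : Series) (s-sqrt : IsSqrt1m4z s) where

  s⊛s : s ⊛ s ≈ 𝟏 ⊝ const (+ 4) ⊛ X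
  s⊛s = R.trans (mk≈ (proj₂ s-sqrt)) (R.trans (poly-horner 1−4XCoeffs)
    (solve 1 (λ x → :horner x 1−4XCoeffs := :1 :- con (+ 4) :* x) R.refl X))

  2X 1−s 1+s : Series
  2X  = const (+ 2) ⊛ X
  1−s = 𝟏 ⊝ s
  1+s = 𝟏 ⊕ s

  -- The error `E n` of the Catalan root satisfies the first-order recursion of the other root, (1 +
  -- s) E n = 2X E (n+1), which has no nonzero power series solution.
  a-ratio : ∀ n → 2X ⊛ a (suc n) ≈ 1−s ⊛ a n
  a-ratio n = zero-⊝ (shift-vanish 1+s (const (+ 2)) 1+s₀≢0 E step n)
    where
    E : ℕ → Series
    E n = 2X ⊛ a (suc n) ⊝ 1−s ⊛ a n
    -- This is where the branch of the square root matters: with constant term -1 for s, the series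
    -- 1 + s would start with 0.
    1+s₀≢0 : ¬ 1+s 0 ≡ + 0
    1+s₀≢0 p with trans (sym (cong (_+ℤ_ (+ 1)) (proj₁ s-sqrt))) p
    ... | ()
    step : ∀ n → 1+s ⊛ E n ≈ X ⊛ (const (+ 2) ⊛ E (suc n))
    step n = combine (const (+ 4) ⊛ X · a-recurrence n ∷ a n · s⊛s ∷ [])
      (solve 5 (λ x s a₀ a₁ a₂ →
        (:1 :+ s) :* (con (+ 2) :* x :* a₁ :- (:1 :- s) :* a₀) :-
          x :* (con (+ 2) :* (con (+ 2) :* x :* a₂ :- (:1 :- s) :* a₁)) :=
        con (+ 4) :* x :* (a₁ :- (a₀ :+ x :* a₂)) :+ (a₀ :* (s :* s :- (:1 :- con (+ 4) :* x)) :+ :0))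
        R.refl X s (a n) (a (suc n)) (a (suc (suc n))))

  -- By a-ratio, a₀-equation becomes q a₀ = 2 hB.
  q : Series
  q = horner qCoeffs ⊕ s ⊛ hM

  P : Series
  P = gf (G 0 0)

  -- From P = 1 + X c 0 one gets 2(1 - X)(P - 1) = 2X + X(1 - s) a 0. Multiplication by `q` replaces
  -- q a 0 by 2 `hB`, and the terms with `hB` cancel.
  P-equation : const (+ 2) ⊛ 1−X ⊛ q ⊛ (P ⊝ 𝟏) ≈ 2X ⊛ (1−2X ⊛ (1−X ⊛ 1−X)) ⊛ 1+s
  P-equation = combine
    (const (+ 2) ⊛ 1−X ⊛ q · G-equation 0 0 ∷ 2X ⊛ q · c₀-equation ∷ X ⊛ q · a-ratio 0 ∷
     ⊖ (2X ⊛ 1−s) · a₀-equation ∷ X ⊛ 1−s ⊛ hM · a-ratio 0 ∷ [])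
    (solve 6 (λ x s a₀ a₁ c₀ p →
      let y = :1 :- x; z = :1 :- con (+ 2) :* x; t = con (+ 2) :* x; r = :1 :- s
          B = :horner x polBCoeffs
          M = :horner x mCoeffs
          q = :horner x qCoeffs :+ s :* M
      in
      con (+ 2) :* y :* q :* (p :- :1) :- t :* (z :* (y :* y)) :* (:1 :+ s) :=
      con (+ 2) :* y :* q :* (p :- (:1 :+ x :* (:0 :+ (c₀ :+ :0)))) :+
      (t :* q :* (y :* c₀ :- (:1 :+ x :* a₁)) :+
      (x :* q :* (t :* a₁ :- r :* a₀) :+
      (:- (t :* r) :* (B :+ x :* a₁ :* M :- z :* (y :* y) :* a₀) :+
      (x :* r :* M :* (t :* a₁ :- r :* a₀) :+ :0)))))
      R.refl X s (a 0) (a 1) (c 0) P)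

  P-closed : P ⊛ hDen ≈ hDen ⊕ hFac ⊛ (hA ⊕ hB ⊛ s)
  P-closed = zero-⊝ (⊛-cancel-zero (const (+ 2) ⊛ 1−X ⊛ q) W leading multiple)
    where
    identity : q ⊛ (hA ⊕ hB ⊛ s) ≈ hDen ⊛ 1+s
    -- `hM ⊛ hB` is the coefficient of s² on the left, the only place where s² has to be replaced by
    -- 1 - 4X. The identity rationalises (1 + s)/q.
    identity = combine (hM ⊛ hB · s⊛s ∷ [])
      (solve 2 (λ x s →
        let B = :horner x polBCoeffs
            M = :horner x mCoeffs
            q = :horner x qCoeffs :+ s :* M
            D = :horner x denCoeffs
            A = :horner x polACoeffs
        in
        q :* (A :+ B :* s) :- D :* (:1 :+ s) := M :* B :* (s :* s :- (:1 :- con (+ 4) :* x)) :+ :0)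
        R.refl X s)
    W : Series
    W = P ⊛ hDen ⊝ (hDen ⊕ hFac ⊛ (hA ⊕ hB ⊛ s))
    q₀ : q 0 ≡ + 2
    q₀ = cong (λ u → + 0 +ℤ (u *ℤ + 2 +ℤ + 0)) (proj₁ s-sqrt)
    leading : ¬ (const (+ 2) ⊛ 1−X ⊛ q) 0 ≡ + 0
    leading p with trans (sym (trans (⊛-zero (const (+ 2) ⊛ 1−X) q) (cong (_*ℤ_ (+ 2)) q₀))) p
    ... | ()
    multiple : const (+ 2) ⊛ 1−X ⊛ q ⊛ W ≈ poly []
    multiple = R.trans (combine {q = const (+ 0)}
      (hDen · P-equation ∷ ⊖ (2X ⊛ (1−2X ⊛ (1−X ⊛ 1−X))) · identity ∷ [])
      -- Only `hFac` is expanded: 2(1 - X) `hFac` equals 2X(1 - 2X)(1 - X)², the factor on the right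
      -- of `P-equation`.
      (solve 7 (λ x s p q D A B →
        let y = :1 :- x; z = :1 :- con (+ 2) :* x; t = con (+ 2) :* x
            F = :horner x facCoeffs
        in
        con (+ 2) :* y :* q :* (p :* D :- (D :+ F :* (A :+ B :* s))) :- :0 :=
        D :* (con (+ 2) :* y :* q :* (p :- :1) :- t :* (z :* (y :* y)) :* (:1 :+ s)) :+
        (:- (t :* (z :* (y :* y))) :* (q :* (A :+ B :* s) :- D :* (:1 :+ s)) :+ :0))
        R.refl X s P q hDen hA hB))
      (R.sym (poly-horner []))

theorem1p3 : (s : Series) → IsSqrt1m4z s →
    ∀ n → (P3 ⊛ Den) n ≡ (Den ⊕ (Fac ⊛ (PolA ⊕ (PolB ⊛ s)))) n
theorem1p3 s s-sqrt = at (R.trans P3⊛Den (R.trans (P-closed s s-sqrt) (R.sym numerator)))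
  where
  P3⊛Den : P3 ⊛ Den ≈ gf (G 0 0) ⊛ hDen
  P3⊛Den = ⊛-cong {P3} {gf (G 0 0)} {Den} {hDen}
    (mk≈ λ n → cong +_ (countAv-descendants n)) (poly-horner denCoeffs)
  numerator : Den ⊕ Fac ⊛ (PolA ⊕ PolB ⊛ s) ≈ hDen ⊕ hFac ⊛ (hA ⊕ hB ⊛ s)
  numerator = ⊕-cong {Den} {hDen} (poly-horner denCoeffs)
    (⊛-cong {Fac} {hFac} (poly-horner facCoeffs)
    (⊕-cong {PolA} {hA} (poly-horner polACoeffs)
    (⊛-cong {PolB} {hB} {s} {s} (poly-horner polBCoeffs) R.refl)))
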